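{- For each integer $n>16$ let $G_n$ be the signed network on vertex set $\{1,\dots,n\}$ whose underlying graph is the complete graph and whose negative edges are exactly the edges $\{i,i+1\}$ for $1\le i\le n-1$ together with $\{n,1\}$ (a Hamiltonian cycle), all other edges being positive. Let $A$ be the signed adjacency matrix of $G_n$, let $\mathbf{x}$ be the random output of Random-Eigensign on input $A$, and let \[ OPT=\max_{\mathbf{y}\in\{ -1,0,1\}^n\setminus\{0\}}\frac{\mathbf{y}^TA\,\mathbf{y}}{\mathbf{y}^T\mathbf{y}}. \] Then, as $n\to\infty$, \[ \mathbb{E}\!\left[\frac{\mathbf{x}^TA\,\mathbf{x}}{\mathbf{x}^T\mathbf{x}}\right]=\Theta(\sqrt n)=\Theta\!\left(\frac{OPT}{\sqrt n}\right). \]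
   Context: A signed network is a finite simple undirected graph whose edges are partitioned into positive and negative edges. Its signed adjacency matrix $A$ is the symmetric matrix with $A_{ij}=1$ if $\{i,j\}$ is a positive edge, $A_{ij}=-1$ if $\{i,j\}$ is a negative edge, and $A_{ij}=0$ otherwise (in particular $A_{ii}=0$). Algorithm Random-Eigensign, on input $A$: (1) compute $\mathbf{v}$, an eigenvector of $A$ with $\|\mathbf{v}\|_2=1$ corresponding to the largest eigenvalue $\lambda_1$ of $A$; (2) independently for each $i\in\{1,\dots,n\}$, run a Bernoulli experiment with success probability $|v_i|$; if it succeeds set $x_i=\mathrm{sgn}(v_i)$, otherwise set $x_i=0$; (3) output $\mathbf{x}$. The ratio $\mathbf{x}^TA\mathbf{x}/\mathbf{x}^T\mathbf{x}$ is taken to be $0$ when $\mathbf{x}=0$. -}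

module Defs where

open import Level using (0ℓ)
open import Algebra.Bundles using (CommutativeRing)
import Algebra.Definitions.RawMonoid as RawMonoidDefs
import Algebra.Properties.Ring as RingProperties
open import Data.Bool.Base using (Bool; true; false; if_then_else_)
open import Data.Empty using (⊥-elim)
open import Data.Fin.Base using (Fin; toℕ)
import Data.Fin.Properties as Fin
open import Data.List.Base as List using (List; []; _∷_; _++_)
open import Data.Maybe.Base using (Maybe; just; nothing)
open import Data.Nat.Base as ℕ using (ℕ; zero; suc)
import Data.Nat.Properties as ℕ
open import Data.Product.Base using (Σ; ∃; _×_; _,_; proj₁; proj₂)
open import Data.Sign.Base using (Sign)
open import Data.Sum.Base using (_⊎_; inj₁; inj₂)
open import Data.Vec.Base as Vec using (Vec)
open import Data.Vec.Functional using (Vector)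
open import Relation.Binary.Core using (Rel)
open import Relation.Binary.Bundles using (StrictTotalOrder)
open import Relation.Binary.Definitions using (tri<; tri≈; tri>)
open import Relation.Binary.PropositionalEquality.Core as ≡ using (_≡_)
open import Relation.Binary.Structures using (IsStrictTotalOrder)
import Relation.Binary.Properties.StrictTotalOrder as STOProperties
import Relation.Binary.Reasoning.StrictPartialOrder as SPOReasoning
open import Relation.Nullary.Decidable.Core using (Dec; yes; no; _⊎-dec_; _×-dec_)
open import Relation.Nullary.Negation.Core using (¬_)

-- The standard library has no real numbers, so ℝ is given by its usual
-- axioms: a totally ordered field in which every inhabited set that is
-- bounded above has a least upper bound.  Classically this determines ℝ
-- up to unique isomorphism.  The order is classical (trichotomous), so
-- the sign of a real number is a function of that number.

record RealNumbers : Set₁ where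
  field
    commutativeRing : CommutativeRing 0ℓ 0ℓ

  open CommutativeRing commutativeRing public

  infix 4 _<_ _≤_

  field
    _<_                : Rel Carrier 0ℓ
    isStrictTotalOrder : IsStrictTotalOrder _≈_ _<_
    0<1                : 0# < 1#
    +-monoˡ-<          : ∀ {x y} z → x < y → x + z < y + z
    *-pos              : ∀ {x y} → 0# < x → 0# < y → 0# < x * y
    inverse            : ∀ x → ¬ x ≈ 0# → ∃ λ y → x * y ≈ 1#

  _≤_ : Rel Carrier 0ℓ
  x ≤ y = x < y ⊎ x ≈ y

  IsUpperBound : (Carrier → Set) → Carrier → Set
  IsUpperBound P b = ∀ x → P x → x ≤ b

  IsSupremum : (Carrier → Set) → Carrier → Set
  IsSupremum P s = IsUpperBound P s × (∀ b → IsUpperBound P b → s ≤ b)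

  field
    supremum : (P : Carrier → Set) → ∃ P → ∃ (IsUpperBound P) → ∃ (IsSupremum P)

  strictTotalOrder : StrictTotalOrder 0ℓ 0ℓ 0ℓ
  strictTotalOrder = record { isStrictTotalOrder = isStrictTotalOrder }

  open StrictTotalOrder strictTotalOrder public
    using (compare; _≟_; strictPartialOrder)

module RealProperties (ℝ : RealNumbers) where

  open RealNumbers ℝ
  open import Algebra.Solver.Ring.NaturalCoefficients.Default commutativeSemiring
  open SPOReasoning strictPartialOrder
  private
    module O = StrictTotalOrder strictTotalOrder
    module T = STOProperties strictTotalOrder

  private
    id₁ : ∀ x d → x * x + (d * d + (x * d + x * d)) ≈ (x + d) * (x + d)
    id₁ = solve 2 (λ x d → x :* x :+ (d :* d :+ (x :* d :+ x :* d))
                             := (x :+ d) :* (x :+ d)) refl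

    id₂ : ∀ a → a + (1# + (a + a * a)) ≈ (1# + a) * (1# + a)
    id₂ = solve 1 (λ a → a :+ (con 1 :+ (a :+ a :* a))
                           := (con 1 :+ a) :* (con 1 :+ a)) refl

    id₃ : ∀ d i s → d * i + (1# + (s + s)) * i ≈ (1# + ((s + s) + d)) * i
    id₃ = solve 3 (λ d i s → d :* i :+ (con 1 :+ (s :+ s)) :* i
                               := (con 1 :+ ((s :+ s) :+ d)) :* i) refl

    id₄ : ∀ s h → (s + h) * (s + h) ≈ (s * s + h * (s + s)) + h * h
    id₄ = solve 2 (λ s h → (s :+ h) :* (s :+ h)
                             := (s :* s :+ h :* (s :+ s)) :+ h :* h) refl

    id₅ : ∀ s h d → ((s * s + h * (s + s)) + h) + h * d
                      ≈ s * s + h * (1# + ((s + s) + d))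
    id₅ = solve 3 (λ s h d → ((s :* s :+ h :* (s :+ s)) :+ h) :+ h :* d
                               := s :* s :+ h :* (con 1 :+ ((s :+ s) :+ d))) refl

    id₆ : ∀ s i a d → (s * s * i + a * i) + d * i ≈ (s * s + (a + d)) * i
    id₆ = solve 4 (λ s i a d → (s :* s :* i :+ a :* i) :+ d :* i
                                 := (s :* s :+ (a :+ d)) :* i) refl

    id₇ : ∀ s i → (s * s + s * s) * i ≈ s * ((s + s) * i)
    id₇ = solve 2 (λ s i → (s :* s :+ s :* s) :* i := s :* ((s :+ s) :* i)) refl

    id₈ : ∀ s i d → d * ((s + s) * i) ≈ (s + s) * (d * i)
    id₈ = solve 3 (λ s i d → d :* ((s :+ s) :* i) := (s :+ s) :* (d :* i)) refl

    id₉ : ∀ t u → t * t + ((t + u) + (t + u)) * u ≈ (t + u) * (t + u) + u * u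
    id₉ = solve 2 (λ t u → t :* t :+ ((t :+ u) :+ (t :+ u)) :* u
                             := (t :+ u) :* (t :+ u) :+ u :* u) refl

    id₁₀ : ∀ x y z → x + (y + z) ≈ y + (x + z)
    id₁₀ = solve 3 (λ x y z → x :+ (y :+ z) := y :+ (x :+ z)) refl

    id₁₁ : ∀ a d x → (a + d) + x ≈ (a + x) + d
    id₁₁ = solve 3 (λ a d x → (a :+ d) :+ x := (a :+ x) :+ d) refl

  +-monoʳ-< : ∀ {x y} z → x < y → z + x < z + y
  +-monoʳ-< {x} {y} z x<y = begin-strict
    z + x  ≈⟨ +-comm z x ⟩
    x + z  <⟨ +-monoˡ-< z x<y ⟩
    y + z  ≈⟨ +-comm y z ⟩
    z + y  ∎

  x<x+d : ∀ x {d} → 0# < d → x < x + d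
  x<x+d x {d} 0<d = begin-strict
    x       ≈⟨ +-identityʳ x ⟨
    x + 0#  <⟨ +-monoʳ-< x 0<d ⟩
    x + d   ∎

  x≤x+d : ∀ x {d} → 0# ≤ d → x ≤ x + d
  x≤x+d x (inj₁ 0<d) = inj₁ (x<x+d x 0<d)
  x≤x+d x (inj₂ 0≈d) = inj₂ (trans (sym (+-identityʳ x)) (+-congˡ 0≈d))

  +-nonneg : ∀ {x y} → 0# ≤ x → 0# ≤ y → 0# ≤ x + y
  +-nonneg {x} 0≤x 0≤y = T.trans 0≤x (x≤x+d x 0≤y)

  +-pos : ∀ {x y} → 0# < x → 0# ≤ y → 0# < x + y
  +-pos {x} 0<x 0≤y = begin-strict
    0#     <⟨ 0<x ⟩
    x      ≤⟨ x≤x+d x 0≤y ⟩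
    x + _  ∎

  *-nonneg : ∀ {x y} → 0# ≤ x → 0# ≤ y → 0# ≤ x * y
  *-nonneg (inj₁ 0<x) (inj₁ 0<y) = inj₁ (*-pos 0<x 0<y)
  *-nonneg {x} {y} (inj₂ 0≈x) _  = inj₂ (trans (sym (zeroˡ y)) (*-congʳ 0≈x))
  *-nonneg {x} {y} _ (inj₂ 0≈y)  = inj₂ (trans (sym (zeroʳ x)) (*-congˡ 0≈y))

  difference : ∀ {x y} → x < y → ∃ λ d → 0# < d × x + d ≈ y
  difference {x} {y} x<y = y + - x , pos , eq
    where
    pos = begin-strict
      0#        ≈⟨ -‿inverseʳ x ⟨
      x + - x   <⟨ +-monoˡ-< (- x) x<y ⟩
      y + - x   ∎
    eq = begin-equality
      x + (y + - x)
          ≈⟨ id₁₀ x y (- x) ⟩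
      y + (x + - x)  ≈⟨ +-congˡ (-‿inverseʳ x) ⟩
      y + 0#         ≈⟨ +-identityʳ y ⟩
      y              ∎

  pos⇒≉0 : ∀ {x} → 0# < x → ¬ x ≈ 0#
  pos⇒≉0 0<x x≈0 = O.irrefl (sym x≈0) 0<x

  pos-inverse : ∀ {x} → 0# < x → ∃ λ y → 0# < y × x * y ≈ 1#
  pos-inverse {x} 0<x with inverse x (pos⇒≉0 0<x)
  ... | y , xy≈1 with compare 0# y
  ...   | tri< 0<y _ _ = y , 0<y , xy≈1
  ...   | tri≈ _ 0≈y _ = ⊥-elim (O.irrefl
            (trans (sym (zeroʳ x)) (trans (*-congˡ 0≈y) xy≈1)) 0<1)
  ...   | tri> _ _ y<0 with difference y<0
  ...     | d , 0<d , y+d≈0 = ⊥-elim (O.irrefl (sym sum≈0) (+-pos 0<1 (inj₁ (*-pos 0<x 0<d))))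
    where
    sum≈0 : 1# + x * d ≈ 0#
    sum≈0 = begin-equality
      1# + x * d     ≈⟨ +-congʳ xy≈1 ⟨
      x * y + x * d  ≈⟨ distribˡ x y d ⟨
      x * (y + d)    ≈⟨ *-congˡ y+d≈0 ⟩
      x * 0#         ≈⟨ zeroʳ x ⟩
      0#             ∎

  square-mono-< : ∀ {x y} → 0# ≤ x → x < y → x * x < y * y
  square-mono-< {x} {y} 0≤x x<y with difference x<y
  ... | d , 0<d , x+d≈y = begin-strict
    x * x                          <⟨ x<x+d _ (+-pos (*-pos 0<d 0<d) (+-nonneg xd xd)) ⟩
    x * x + (d * d + (x * d + x * d))
          ≈⟨ id₁ x d ⟩
    (x + d) * (x + d)              ≈⟨ *-cong x+d≈y x+d≈y ⟩
    y * y                          ∎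
    where
    xd : 0# ≤ x * d
    xd = *-nonneg 0≤x (inj₁ 0<d)

  square-reflects-≤ : ∀ {x y} → 0# ≤ y → x * x ≤ y * y → x ≤ y
  square-reflects-≤ {x} {y} 0≤y x²≤y² with compare x y
  ... | tri< x<y _ _ = inj₁ x<y
  ... | tri≈ _ x≈y _ = inj₂ x≈y
  ... | tri> _ _ y<x = ⊥-elim (O.irrefl refl (begin-strict
    x * x  ≤⟨ x²≤y² ⟩
    y * y  <⟨ square-mono-< 0≤y y<x ⟩
    x * x  ∎))

  +-monoʳ-≤ : ∀ z {x y} → x ≤ y → z + x ≤ z + y
  +-monoʳ-≤ z (inj₁ x<y) = inj₁ (+-monoʳ-< z x<y)
  +-monoʳ-≤ z (inj₂ x≈y) = inj₂ (+-congˡ x≈y)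

  square-≤-self : ∀ {x} → 0# ≤ x → x ≤ 1# → x * x ≤ x
  square-≤-self {x} 0≤x (inj₂ x≈1) = inj₂ (trans (*-congˡ x≈1) (*-identityʳ x))
  square-≤-self {x} 0≤x (inj₁ x<1) with difference x<1
  ... | e , 0<e , x+e≈1 = begin
    x * x          ≤⟨ x≤x+d _ (*-nonneg 0≤x (inj₁ 0<e)) ⟩
    x * x + x * e  ≈⟨ distribˡ x x e ⟨
    x * (x + e)    ≈⟨ *-congˡ x+e≈1 ⟩
    x * 1#         ≈⟨ *-identityʳ x ⟩
    x              ∎

  -- A suitable h is d / (1 + 2s + d), where d = a − s².
  enlarge : ∀ {s a} → 0# ≤ s → s * s < a →
            ∃ λ h → 0# < h × (s + h) * (s + h) ≤ a
  enlarge {s} {a} 0≤s s²<a with difference s²<a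
  ... | d , 0<d , s²+d≈a
    with pos-inverse (+-pos 0<1 (+-nonneg (+-nonneg 0≤s 0≤s) (inj₁ 0<d)))
  ...   | i , 0<i , mi≈1 =
    d * i , 0<h , below (d * i) (inj₁ 0<h) (square-≤-self (inj₁ 0<h) h≤1) hm≈d
    where
    0<h : 0# < d * i
    0<h = *-pos 0<d 0<i
    hm≈d : d * i * (1# + ((s + s) + d)) ≈ d
    hm≈d = begin-equality
      d * i * (1# + ((s + s) + d))    ≈⟨ *-assoc d i _ ⟩
      d * (i * (1# + ((s + s) + d)))  ≈⟨ *-congˡ (*-comm i _) ⟩
      d * ((1# + ((s + s) + d)) * i)  ≈⟨ *-congˡ mi≈1 ⟩
      d * 1#                          ≈⟨ *-identityʳ d ⟩
      d                               ∎
    h≤1 : d * i ≤ 1#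
    h≤1 = begin
      d * i
        ≤⟨ x≤x+d _ (*-nonneg (+-nonneg (inj₁ 0<1) (+-nonneg 0≤s 0≤s)) (inj₁ 0<i)) ⟩
      d * i + (1# + (s + s)) * i      ≈⟨ id₃ d i s ⟩
      (1# + ((s + s) + d)) * i        ≈⟨ mi≈1 ⟩
      1#                              ∎
    below : ∀ h → 0# ≤ h → h * h ≤ h → h * (1# + ((s + s) + d)) ≈ d →
            (s + h) * (s + h) ≤ a
    below h 0≤h h²≤h hm≈d = begin
      (s + h) * (s + h)                    ≈⟨ id₄ s h ⟩
      (s * s + h * (s + s)) + h * h        ≤⟨ +-monoʳ-≤ _ h²≤h ⟩
      (s * s + h * (s + s)) + h            ≤⟨ x≤x+d _ (*-nonneg 0≤h (inj₁ 0<d)) ⟩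
      ((s * s + h * (s + s)) + h) + h * d  ≈⟨ id₅ s h d ⟩
      s * s + h * (1# + ((s + s) + d))     ≈⟨ +-congˡ hm≈d ⟩
      s * s + d                            ≈⟨ s²+d≈a ⟩
      a                                    ∎

  -- A suitable t is s − u = (s² + a) / 2s, where u = (s² − a) / 2s.
  shrink : ∀ {s a} → 0# < s → 0# ≤ a → a < s * s →
           ∃ λ t → 0# ≤ t × t < s × a ≤ t * t
  shrink {s} {a} 0<s 0≤a a<s² with difference a<s² | pos-inverse (+-pos 0<s (inj₁ 0<s))
  ... | d , 0<d , a+d≈s² | i , 0<i , mi≈1 =
    t , 0≤t , t<s (d * i) 0<u t+u≈s , a≤t² t (d * i) 0<u t+u≈s d≈2su
    where
    t : Carrier
    t = s * s * i + a * i
    0<u : 0# < d * i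
    0<u = *-pos 0<d 0<i
    0≤t : 0# ≤ t
    0≤t = +-nonneg (inj₁ (*-pos (*-pos 0<s 0<s) 0<i)) (*-nonneg 0≤a (inj₁ 0<i))
    t+u≈s : t + d * i ≈ s
    t+u≈s = begin-equality
      (s * s * i + a * i) + d * i  ≈⟨ id₆ s i a d ⟩
      (s * s + (a + d)) * i        ≈⟨ *-congʳ (+-congˡ a+d≈s²) ⟩
      (s * s + s * s) * i          ≈⟨ id₇ s i ⟩
      s * ((s + s) * i)            ≈⟨ *-congˡ mi≈1 ⟩
      s * 1#                       ≈⟨ *-identityʳ s ⟩
      s                            ∎
    d≈2su : d ≈ (s + s) * (d * i)
    d≈2su = begin-equality
      d                  ≈⟨ *-identityʳ d ⟨
      d * 1#             ≈⟨ *-congˡ mi≈1 ⟨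
      d * ((s + s) * i)  ≈⟨ id₈ s i d ⟩
      (s + s) * (d * i)  ∎
    t<s : ∀ u → 0# < u → t + u ≈ s → t < s
    t<s u 0<u t+u≈s = begin-strict
      t      <⟨ x<x+d t 0<u ⟩
      t + u  ≈⟨ t+u≈s ⟩
      s      ∎
    a≤t² : ∀ t u → 0# < u → t + u ≈ s → d ≈ (s + s) * u → a ≤ t * t
    a≤t² t u 0<u t+u≈s d≈2su = begin
      a          ≤⟨ x≤x+d a (inj₁ (*-pos 0<u 0<u)) ⟩
      a + u * u  ≈⟨ RingProperties.+-cancelʳ ring d (t * t) (a + u * u) (begin-equality
        t * t + d                        ≈⟨ +-congˡ d≈2su ⟩
        t * t + (s + s) * u              ≈⟨ +-congˡ (*-congʳ (+-cong t+u≈s t+u≈s)) ⟨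
        t * t + ((t + u) + (t + u)) * u  ≈⟨ id₉ t u ⟩
        (t + u) * (t + u) + u * u        ≈⟨ +-congʳ (*-cong t+u≈s t+u≈s) ⟩
        s * s + u * u                    ≈⟨ +-congʳ a+d≈s² ⟨
        (a + d) + u * u                  ≈⟨ id₁₁ a d (u * u) ⟩
        (a + u * u) + d                  ∎) ⟨
      t * t      ∎

  <⇒≱ : ∀ {x y} → x < y → ¬ y ≤ x
  <⇒≱ x<y (inj₁ y<x) = O.asym x<y y<x
  <⇒≱ x<y (inj₂ y≈x) = O.irrefl (sym y≈x) x<y

  ≤-respˡ-≈ : ∀ {x y z} → x ≈ y → x ≤ z → y ≤ z
  ≤-respˡ-≈ x≈y = T.trans (inj₂ (sym x≈y))

  sqrt-exists : ∀ a → 0# ≤ a → ∃ λ s → 0# ≤ s × s * s ≈ a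
  sqrt-exists a 0≤a = root (supremum Below (0# , below-0) (1# + a , bound))
    where
    Below : Carrier → Set
    Below x = 0# ≤ x × x * x ≤ a

    below-0 : Below 0#
    below-0 = inj₂ refl , (begin 0# * 0# ≈⟨ zeroʳ 0# ⟩ 0# ≤⟨ 0≤a ⟩ a ∎)

    bound : IsUpperBound Below (1# + a)
    bound x (_ , x²≤a) = square-reflects-≤ (+-nonneg (inj₁ 0<1) 0≤a) (begin
      x * x                  ≤⟨ x²≤a ⟩
      a                      ≤⟨ x≤x+d a (+-nonneg (inj₁ 0<1) (+-nonneg 0≤a (*-nonneg 0≤a 0≤a))) ⟩
      a + (1# + (a + a * a)) ≈⟨ id₂ a ⟩
      (1# + a) * (1# + a)    ∎)

    root : ∃ (IsSupremum Below) → ∃ λ s → 0# ≤ s × s * s ≈ a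
    root (s , upper , least) = s , 0≤s , s²≈a
      where
      0≤s : 0# ≤ s
      0≤s = upper 0# below-0

      not-below : ¬ s * s < a
      not-below s²<a = let h , 0<h , [s+h]²≤a = enlarge 0≤s s²<a in
        <⇒≱ (x<x+d s 0<h) (upper (s + h) (+-nonneg 0≤s (inj₁ 0<h) , [s+h]²≤a))

      not-above : 0# ≤ s → ¬ a < s * s
      not-above (inj₂ 0≈s) a<s² =
        <⇒≱ a<s² (≤-respˡ-≈ (trans (sym (zeroˡ s)) (*-congʳ 0≈s)) 0≤a)
      not-above (inj₁ 0<s) a<s² = let t , 0≤t , t<s , a≤t² = shrink 0<s 0≤a a<s² in
        <⇒≱ t<s (least t (λ x x∈ → square-reflects-≤ 0≤t (T.trans (proj₂ x∈) a≤t²)))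

      s²≈a : s * s ≈ a
      s²≈a with compare (s * s) a
      ... | tri< s²<a _ _ = ⊥-elim (not-below s²<a)
      ... | tri≈ _ s²≈a _ = s²≈a
      ... | tri> _ _ a<s² = ⊥-elim (not-above 0≤s a<s²)

module RealOperations (ℝ : RealNumbers) where

  open RealNumbers ℝ
  open RealProperties ℝ using (sqrt-exists)

  fromℕ : ℕ → Carrier
  fromℕ n = n ×ℕ 1#
    where open RawMonoidDefs +-rawMonoid using () renaming (_×_ to _×ℕ_)

  -- The functions are total: 0⁻¹ = 0, and √ x = 0 for negative x.

  infix 8 _⁻¹
  _⁻¹ : Carrier → Carrier
  x ⁻¹ with x ≟ 0#
  ... | yes _   = 0#
  ... | no x≉0  = proj₁ (inverse x x≉0)

  infixl 7 _/_
  _/_ : Carrier → Carrier → Carrier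
  x / y = x * y ⁻¹

  √_ : Carrier → Carrier
  √ x with compare 0# x
  ... | tri< 0<x _ _ = proj₁ (sqrt-exists x (inj₁ 0<x))
  ... | tri≈ _ _ _   = 0#
  ... | tri> _ _ _   = 0#

  ∣_∣ : Carrier → Carrier
  ∣ x ∣ with compare x 0#
  ... | tri< _ _ _ = - x
  ... | tri≈ _ _ _ = x
  ... | tri> _ _ _ = x

  sgn : Carrier → Carrier
  sgn x with compare x 0#
  ... | tri< _ _ _ = - 1#
  ... | tri≈ _ _ _ = 0#
  ... | tri> _ _ _ = 1#

  ∑ : ∀ {n} → Vector Carrier n → Carrier
  ∑ = RawMonoidDefs.sum +-rawMonoid

  ∏ : ∀ {n} → Vector Carrier n → Carrier
  ∏ = RawMonoidDefs.sum *-rawMonoid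

  -- As n → ∞, so only eventual bounds are required.
  infix 4 _∈Θ_
  _∈Θ_ : (ℕ → Carrier) → (ℕ → Carrier) → Set
  f ∈Θ g = Σ Carrier λ c → Σ Carrier λ C → 0# < c × 0# < C × Σ ℕ λ N →
    ∀ n → N ℕ.≤ n → 0# ≤ c * g n × c * g n ≤ f n × f n ≤ C * g n

-- edge i j is  just s  if {i , j} is an edge of sign s, and  nothing  if
-- {i , j} is not an edge.

record SignedNetwork (n : ℕ) : Set where
  field
    edge        : Fin n → Fin n → Maybe Sign
    edge-sym    : ∀ i j → edge i j ≡ edge j i
    edge-irrefl : ∀ i → edge i i ≡ nothing

-- Vertices are numbered 0, …, n−1; the successor of n−1 is 0.

Next : ∀ {n} → Fin n → Fin n → Set
Next {n} i j = (suc (toℕ i) ≡ toℕ j) ⊎ ((suc (toℕ i) ≡ n) × (toℕ j ≡ 0))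

CycleEdge : ∀ {n} → Fin n → Fin n → Set
CycleEdge i j = Next i j ⊎ Next j i

next? : ∀ {n} (i j : Fin n) → Dec (Next i j)
next? {n} i j =
  (suc (toℕ i) ℕ.≟ toℕ j) ⊎-dec ((suc (toℕ i) ℕ.≟ n) ×-dec (toℕ j ℕ.≟ 0))

cycleEdge? : ∀ {n} (i j : Fin n) → Dec (CycleEdge i j)
cycleEdge? i j = next? i j ⊎-dec next? j i

G : ∀ n → SignedNetwork n
G n = record { edge = edge ; edge-sym = edge-sym ; edge-irrefl = edge-irrefl }
  where
  edge : Fin n → Fin n → Maybe Sign
  edge i j with i Fin.≟ j | cycleEdge? i j
  ... | yes _ | _     = nothing
  ... | no  _ | yes _ = just Sign.-
  ... | no  _ | no  _ = just Sign.+

  swap : ∀ {i j : Fin n} → CycleEdge i j → CycleEdge j i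
  swap (inj₁ p) = inj₂ p
  swap (inj₂ p) = inj₁ p

  edge-sym : ∀ i j → edge i j ≡ edge j i
  edge-sym i j with i Fin.≟ j | cycleEdge? i j | j Fin.≟ i | cycleEdge? j i
  ... | yes _   | _     | yes _   | _     = ≡.refl
  ... | yes i≡j | _     | no  j≢i | _     = ⊥-elim (j≢i (≡.sym i≡j))
  ... | no  i≢j | _     | yes j≡i | _     = ⊥-elim (i≢j (≡.sym j≡i))
  ... | no  _   | yes _ | no  _   | yes _ = ≡.refl
  ... | no  _   | yes p | no  _   | no ¬p = ⊥-elim (¬p (swap p))
  ... | no  _   | no ¬p | no  _   | yes p = ⊥-elim (¬p (swap p))
  ... | no  _   | no  _ | no  _   | no  _ = ≡.refl

  edge-irrefl : ∀ i → edge i i ≡ nothing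
  edge-irrefl i with i Fin.≟ i | cycleEdge? i i
  ... | yes _   | _ = ≡.refl
  ... | no  i≢i | _ = ⊥-elim (i≢i ≡.refl)

outcomes : ∀ n → List (Vec Bool n)
outcomes zero    = Vec.[] ∷ []
outcomes (suc n) =
  List.map (true Vec.∷_) (outcomes n) ++ List.map (false Vec.∷_) (outcomes n)

module Eigensign (ℝ : RealNumbers) where

  open RealNumbers ℝ public
  open RealOperations ℝ public

  Matrix : ℕ → Set
  Matrix n = Fin n → Fin n → Carrier

  adjacency : ∀ {n} → SignedNetwork n → Matrix n
  adjacency H i j with SignedNetwork.edge H i j
  ... | just Sign.+ = 1#
  ... | just Sign.- = - 1#
  ... | nothing     = 0#

  _·_ : ∀ {n} → Vector Carrier n → Vector Carrier n → Carrier
  x · y = ∑ λ i → x i * y i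

  _*ᵥ_ : ∀ {n} → Matrix n → Vector Carrier n → Vector Carrier n
  (A *ᵥ x) i = A i · x

  ‖_‖₂ : ∀ {n} → Vector Carrier n → Carrier
  ‖ x ‖₂ = √ (x · x)

  IsZero : ∀ {n} → Vector Carrier n → Set
  IsZero x = ∀ i → x i ≈ 0#

  -- xᵀAx / xᵀx.  As 0⁻¹ = 0, this is 0 when x = 0.
  ratio : ∀ {n} → Matrix n → Vector Carrier n → Carrier
  ratio A x = (x · (A *ᵥ x)) / (x · x)

  IsEigenvector : ∀ {n} → Matrix n → Carrier → Vector Carrier n → Set
  IsEigenvector A μ x = ¬ IsZero x × (∀ i → (A *ᵥ x) i ≈ μ * x i)

  IsEigenvalue : ∀ {n} → Matrix n → Carrier → Set
  IsEigenvalue A μ = ∃ (IsEigenvector A μ)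

  IsLargestEigenvalue : ∀ {n} → Matrix n → Carrier → Set
  IsLargestEigenvalue A λ₁ = IsEigenvalue A λ₁ × (∀ μ → IsEigenvalue A μ → μ ≤ λ₁)

  -- The vectors that the first step of the algorithm may return; the
  -- algorithm does not say which of them it computes.
  IsUnitTopEigenvector : ∀ {n} → Matrix n → Vector Carrier n → Set
  IsUnitTopEigenvector A v =
    (∃ λ λ₁ → IsLargestEigenvalue A λ₁ × IsEigenvector A λ₁ v) × ‖ v ‖₂ ≈ 1#

  -- The output of the algorithm when the i-th experiment succeeds exactly
  -- if the i-th entry of ω is true.
  output : ∀ {n} → Vector Carrier n → Vec Bool n → Vector Carrier n
  output v ω i = if Vec.lookup ω i then sgn (v i) else 0#

  -- The probability of ω under independent Bernoulli experiments with
  -- success probabilities ∣ v i ∣.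
  probability : ∀ {n} → Vector Carrier n → Vec Bool n → Carrier
  probability v ω = ∏ λ i → if Vec.lookup ω i then ∣ v i ∣ else (1# - ∣ v i ∣)

  𝔼 : ∀ {n} → Vector Carrier n → (Vec Bool n → Carrier) → Carrier
  𝔼 {n} v f = List.foldr _+_ 0# (List.map (λ ω → probability v ω * f ω) (outcomes n))

  expectedRatio : ∀ {n} → Matrix n → Vector Carrier n → Carrier
  expectedRatio A v = 𝔼 v λ ω → ratio A (output v ω)

  IsFeasible : ∀ {n} → Vector Carrier n → Set
  IsFeasible y = (∀ i → y i ≈ - 1# ⊎ y i ≈ 0# ⊎ y i ≈ 1#) × ¬ IsZero y

  IsOPT : ∀ {n} → Matrix n → Carrier → Set
  IsOPT A m = (∃ λ y → IsFeasible y × ratio A y ≈ m)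
            × (∀ y → IsFeasible y → ratio A y ≤ m)

{-# OPTIONS --safe #-}
module Submission where

-- Writing C for the adjacency matrix of the cycle, A + I + 2C is the all-ones
-- matrix.  Hence A·1 = (n − 5)·1, and comparing the rows of A v = λ v at a largest
-- and a smallest entry of v shows that v is constant as soon as λ > 3.  The output x
-- is therefore ± the indicator of a random set S with 𝔼 |S| = n / √n = √n, and, as
-- every vertex lies on only two negative edges, |S| − 5 ≤ xᵀAx / xᵀx ≤ |S|.  In the
-- same way n − 5 ≤ OPT ≤ n.

open import Defs
open import Data.Bool.Base using (Bool; true; false; if_then_else_)
open import Data.Fin.Base as Fin using (Fin; zero; suc; toℕ; fromℕ<; inject₁)
import Data.Fin.Properties as Fin
open import Data.List.Base as List using (List; []; _∷_; _++_)
open import Data.List.Membership.Propositional.Properties using (∈-allFin)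
import Data.List.Properties as List
import Data.List.Extrema as Extrema
import Data.List.Relation.Unary.All as All
open import Data.Maybe.Base using (just; nothing)
open import Data.Nat.Base as ℕ using (ℕ; zero; suc; z≤n; s≤s)
import Data.Nat.Properties as ℕ
open import Data.Product.Base using (∃; _×_; _,_; proj₁; proj₂)
open import Data.Sign.Base using (Sign)
open import Data.Sum.Base using (_⊎_; inj₁; inj₂)
open import Data.Vec.Base as Vec using (Vec)
open import Data.Vec.Functional using (Vector)
open import Function.Base using (_∘_)
open import Relation.Binary.Bundles using (DecTotalOrder)
open import Relation.Binary.Definitions using (tri<; tri≈; tri>)
open import Relation.Binary.PropositionalEquality.Core as ≡ using (_≡_)
import Relation.Binary.Properties.StrictTotalOrder as STOProperties
import Relation.Binary.Reasoning.StrictPartialOrder as SPOReasoning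
open import Relation.Nullary.Decidable.Core using (Dec; yes; no; does)
open import Relation.Nullary.Negation.Core using (¬_; contradiction)

-- The numerator and the denominator of the ratio are dependent random variables, but both bounds on
-- the ratio are linear in |S| and hold for every outcome, the empty set with its ratio 0 included.
-- So monotonicity and linearity of expectation suffice. The 5 is 1 + 2·2, the row sum of I + 2C.
-- For the 3, let a and b be the largest and the smallest entry of v: the sum of v cancels between
-- their rows, and bounding the neighbours of the one by b and of the other by a leaves (λ + 1)(a -
-- b) ≤ 4(a - b). The ring solver in use knows no subtraction, so a loss of 5 appears as a summand
-- on the other side of an inequality, and λ > 3 as 8 < λ + 5.

-- The cyclic successor relation.

next : ∀ {m} (i : Fin (suc m)) → ∃ (Next i)
next {m} i with suc (toℕ i) ℕ.<? suc m
... | yes i+1<n = fromℕ< i+1<n , inj₁ (≡.sym (Fin.toℕ-fromℕ< i+1<n))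
... | no  i+1≮n = zero , inj₂ (ℕ.≤-antisym (Fin.toℕ<n i) (ℕ.≮⇒≥ i+1≮n) , ≡.refl)

previous : ∀ {m} (i : Fin (suc m)) → ∃ λ j → Next j i
previous {m} zero    = Fin.fromℕ m , inj₂ (≡.cong suc (Fin.toℕ-fromℕ m) , ≡.refl)
previous     (suc i) = inject₁ i , inj₁ (≡.cong suc (Fin.toℕ-inject₁ i))

Next-functional : ∀ {n} {i j k : Fin n} → Next i j → Next i k → j ≡ k
Next-functional (inj₁ p) (inj₁ q) = Fin.toℕ-injective (≡.trans (≡.sym p) q)
Next-functional {j = j} (inj₁ p) (inj₂ (q , _)) =
  contradiction (≡.trans (≡.sym p) q) (ℕ.<⇒≢ (Fin.toℕ<n j))
Next-functional {k = k} (inj₂ (p , _)) (inj₁ q) =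
  contradiction (≡.trans (≡.sym q) p) (ℕ.<⇒≢ (Fin.toℕ<n k))
Next-functional (inj₂ (_ , p)) (inj₂ (_ , q)) = Fin.toℕ-injective (≡.trans p (≡.sym q))

Next-injective : ∀ {n} {i j k : Fin n} → Next i k → Next j k → i ≡ j
Next-injective (inj₁ p) (inj₁ q) =
  Fin.toℕ-injective (ℕ.suc-injective (≡.trans p (≡.sym q)))
Next-injective (inj₁ p) (inj₂ (_ , q)) = contradiction (≡.trans p q) λ ()
Next-injective (inj₂ (_ , p)) (inj₁ q) = contradiction (≡.trans q p) λ ()
Next-injective (inj₂ (p , _)) (inj₂ (q , _)) =
  Fin.toℕ-injective (ℕ.suc-injective (≡.trans p (≡.sym q)))

Next-irrefl : ∀ {n} → 2 ℕ.< n → {i : Fin n} → ¬ Next i i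
Next-irrefl _ (inj₁ p) = contradiction p ℕ.1+n≢n
Next-irrefl 2<n (inj₂ (p , q)) =
  contradiction (≡.trans (≡.cong suc (≡.sym q)) p) (ℕ.<⇒≢ (ℕ.<-trans ℕ.≤-refl 2<n))

-- A step back from j to i closes the cycle after two vertices: unless both steps are inner ones,
-- this forces n = 2, or n = 1 if both wrap around. Hence at most one of `Next i j` and `Next j i`
-- holds, and their indicators add up to an entry of C.
Next-asym : ∀ {n} → 2 ℕ.< n → {i j : Fin n} → Next i j → ¬ Next j i
Next-asym _ (inj₁ p) (inj₁ q) =
  contradiction (≡.trans (≡.cong suc p) q) (ℕ.>⇒≢ (ℕ.m≤n+m _ 1))
Next-asym 2<n (inj₁ p) (inj₂ (q , r)) =
  contradiction (≡.trans (≡.cong suc (≡.trans (≡.cong suc (≡.sym r)) p)) q) (ℕ.<⇒≢ 2<n)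
Next-asym 2<n (inj₂ (q , r)) (inj₁ p) =
  contradiction (≡.trans (≡.cong suc (≡.trans (≡.cong suc (≡.sym r)) p)) q) (ℕ.<⇒≢ 2<n)
Next-asym 2<n (inj₂ (p , _)) (inj₂ (_ , q)) =
  contradiction (≡.trans (≡.cong suc (≡.sym q)) p) (ℕ.<⇒≢ (ℕ.<-trans ℕ.≤-refl 2<n))

-- Ordered-field arithmetic, finite sums, and transitivity of Θ.

module OrderedField (ℝ : RealNumbers) where

  open RealNumbers ℝ hiding (zero)
  open RealProperties ℝ
  open RealOperations ℝ
  open import Algebra.Properties.Ring ring using (-‿distribˡ-*; -‿distribʳ-*; -‿involutive)
  open import Algebra.Properties.Semiring.Mult semiring using (×1-homo-*)
  open import Algebra.Properties.Semiring.Sum semiring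
    using (sum-cong-≋; sum-remove; sum-replicate; sum-replicate-zero; *-distribʳ-sum)
  open import Algebra.Solver.Ring.NaturalCoefficients.Default commutativeSemiring
    using (solve; _:=_; _:+_; _:*_; con)
  open SPOReasoning strictPartialOrder
  open DecTotalOrder (STOProperties.decTotalOrder strictTotalOrder) public
    using (totalOrder) renaming (reflexive to ≤-reflexive; trans to ≤-trans; antisym to ≤-antisym)

  ≤-refl : ∀ {x} → x ≤ x
  ≤-refl = inj₂ refl

  +-monoˡ-≤ : ∀ z {x y} → x ≤ y → x + z ≤ y + z
  +-monoˡ-≤ z (inj₁ x<y) = inj₁ (+-monoˡ-< z x<y)
  +-monoˡ-≤ z (inj₂ x≈y) = inj₂ (+-congʳ x≈y)

  +-mono-≤ : ∀ {x y u v} → x ≤ y → u ≤ v → x + u ≤ y + v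
  +-mono-≤ x≤y u≤v = ≤-trans (+-monoˡ-≤ _ x≤y) (+-monoʳ-≤ _ u≤v)

  +-cancelʳ-≤ : ∀ z {x y} → x + z ≤ y + z → x ≤ y
  +-cancelʳ-≤ z {x} {y} x+z≤y+z with compare x y
  ... | tri< x<y _ _ = inj₁ x<y
  ... | tri≈ _ x≈y _ = inj₂ x≈y
  ... | tri> _ _ y<x = contradiction x+z≤y+z (<⇒≱ (+-monoˡ-< z y<x))

  *-monoʳ-< : ∀ {x y z} → 0# < z → x < y → z * x < z * y
  *-monoʳ-< {x} {y} {z} 0<z x<y with d , 0<d , x+d≈y ← difference x<y = begin-strict
    z * x          <⟨ x<x+d _ (*-pos 0<z 0<d) ⟩
    z * x + z * d  ≈⟨ distribˡ z x d ⟨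
    z * (x + d)    ≈⟨ *-congˡ x+d≈y ⟩
    z * y          ∎

  *-monoʳ-≤ : ∀ {x y z} → 0# ≤ z → x ≤ y → z * x ≤ z * y
  *-monoʳ-≤ (inj₁ 0<z) (inj₁ x<y) = inj₁ (*-monoʳ-< 0<z x<y)
  *-monoʳ-≤ (inj₂ 0≈z) (inj₁ x<y) = inj₂ (begin-equality
    _ * _   ≈⟨ *-congʳ 0≈z ⟨
    0# * _  ≈⟨ zeroˡ _ ⟩
    0#      ≈⟨ zeroˡ _ ⟨
    0# * _  ≈⟨ *-congʳ 0≈z ⟩
    _ * _   ∎)
  *-monoʳ-≤ _ (inj₂ x≈y)          = inj₂ (*-congˡ x≈y)

  *-cancelˡ-≤ : ∀ {x y z} → 0# < z → z * x ≤ z * y → x ≤ y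
  *-cancelˡ-≤ {x} {y} 0<z zx≤zy with compare x y
  ... | tri< x<y _ _ = inj₁ x<y
  ... | tri≈ _ x≈y _ = inj₂ x≈y
  ... | tri> _ _ y<x = contradiction zx≤zy (<⇒≱ (*-monoʳ-< 0<z y<x))

  0≤1 : 0# ≤ 1#
  0≤1 = inj₁ 0<1

  x<0⇒0<-x : ∀ {x} → x < 0# → 0# < - x
  x<0⇒0<-x {x} x<0 = begin-strict
    0#        ≈⟨ -‿inverseʳ x ⟨
    x + - x   <⟨ +-monoˡ-< (- x) x<0 ⟩
    0# + - x  ≈⟨ +-identityˡ (- x) ⟩
    - x       ∎

  -x*-x≈x*x : ∀ x → - x * - x ≈ x * x
  -x*-x≈x*x x = begin-equality
    - x * - x      ≈⟨ -‿distribˡ-* x (- x) ⟨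
    - (x * - x)    ≈⟨ -‿cong (-‿distribʳ-* x x) ⟨
    - (- (x * x))  ≈⟨ -‿involutive (x * x) ⟩
    x * x          ∎

  square-injective : ∀ {x y} → 0# ≤ x → 0# ≤ y → x * x ≈ y * y → x ≈ y
  square-injective 0≤x 0≤y x²≈y² = ≤-antisym
    (square-reflects-≤ 0≤y (≤-reflexive x²≈y²))
    (square-reflects-≤ 0≤x (≤-reflexive (sym x²≈y²)))

  square-nonneg : ∀ x → 0# ≤ x * x
  square-nonneg x with compare x 0#
  ... | tri< x<0 _ _ = ≤-trans (inj₁ (*-pos (x<0⇒0<-x x<0) (x<0⇒0<-x x<0))) (≤-reflexive (-x*-x≈x*x x))
  ... | tri≈ _ x≈0 _ = ≤-reflexive (sym (trans (*-congʳ x≈0) (zeroˡ x)))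
  ... | tri> _ _ 0<x = inj₁ (*-pos 0<x 0<x)

  ∣x∣-nonneg : ∀ x → 0# ≤ ∣ x ∣
  ∣x∣-nonneg x with compare x 0#
  ... | tri< x<0 _ _ = inj₁ (x<0⇒0<-x x<0)
  ... | tri≈ _ x≈0 _ = inj₂ (sym x≈0)
  ... | tri> _ _ 0<x = inj₁ 0<x

  ∣x∣*∣x∣≈x*x : ∀ x → ∣ x ∣ * ∣ x ∣ ≈ x * x
  ∣x∣*∣x∣≈x*x x with compare x 0#
  ... | tri< _ _ _ = -x*-x≈x*x x
  ... | tri≈ _ _ _ = refl
  ... | tri> _ _ _ = refl

  -- `∣_∣` is defined by cases on `compare`, so it does not respect `≈` automatically. A nonnegative
  -- number is determined by its square, which replaces a comparison of all pairs of cases.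
  ∣∣-cong : ∀ {x y} → x ≈ y → ∣ x ∣ ≈ ∣ y ∣
  ∣∣-cong {x} {y} x≈y = square-injective (∣x∣-nonneg x) (∣x∣-nonneg y)
    (trans (∣x∣*∣x∣≈x*x x) (trans (*-cong x≈y x≈y) (sym (∣x∣*∣x∣≈x*x y))))

  sgn-cong : ∀ {x y} → x ≈ y → sgn x ≈ sgn y
  sgn-cong {x} {y} x≈y with compare x 0# | compare y 0#
  ... | tri< _   _   _   | tri< _   _   _   = refl
  ... | tri≈ _   _   _   | tri≈ _   _   _   = refl
  ... | tri> _   _   _   | tri> _   _   _   = refl
  ... | tri< _   x≉0 _   | tri≈ _   y≈0 _   = contradiction (trans x≈y y≈0) x≉0
  ... | tri> _   x≉0 _   | tri≈ _   y≈0 _   = contradiction (trans x≈y y≈0) x≉0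
  ... | tri≈ _   x≈0 _   | tri< _   y≉0 _   = contradiction (trans (sym x≈y) x≈0) y≉0
  ... | tri≈ _   x≈0 _   | tri> _   y≉0 _   = contradiction (trans (sym x≈y) x≈0) y≉0
  ... | tri< x<0 _   _   | tri> y≮0 _   _   = contradiction (begin-strict
    y   ≈⟨ x≈y ⟨
    x   <⟨ x<0 ⟩
    0#  ∎) y≮0
  ... | tri> x≮0 _   _   | tri< y<0 _   _   = contradiction (begin-strict
    x   ≈⟨ x≈y ⟩
    y   <⟨ y<0 ⟩
    0#  ∎) x≮0

  sgn-square : ∀ {x} → ¬ x ≈ 0# → sgn x * sgn x ≈ 1#
  sgn-square {x} x≉0 with compare x 0#
  ... | tri< _ _   _ = trans (-x*-x≈x*x 1#) (*-identityʳ 1#)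
  ... | tri≈ _ x≈0 _ = contradiction x≈0 x≉0
  ... | tri> _ _   _ = *-identityʳ 1#

  √-nonneg : ∀ x → 0# ≤ √ x
  √-nonneg x with compare 0# x
  ... | tri< 0<x _ _ = proj₁ (proj₂ (sqrt-exists x (inj₁ 0<x)))
  ... | tri≈ _ _ _   = ≤-refl
  ... | tri> _ _ _   = ≤-refl

  √-square : ∀ {x} → 0# ≤ x → √ x * √ x ≈ x
  √-square {x} 0≤x with compare 0# x
  ... | tri< 0<x _ _ = proj₂ (proj₂ (sqrt-exists x (inj₁ 0<x)))
  ... | tri≈ _ 0≈x _ = trans (zeroˡ 0#) 0≈x
  ... | tri> _ _ x<0 = contradiction 0≤x (<⇒≱ x<0)

  √x≈1⇒x≈1 : ∀ {x} → 0# ≤ x → √ x ≈ 1# → x ≈ 1#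
  √x≈1⇒x≈1 0≤x √x≈1 = trans (sym (√-square 0≤x)) (trans (*-cong √x≈1 √x≈1) (*-identityʳ 1#))

  ⁻¹-inverseʳ : ∀ {x} → ¬ x ≈ 0# → x * x ⁻¹ ≈ 1#
  ⁻¹-inverseʳ {x} x≉0 with x ≟ 0#
  ... | yes x≈0 = contradiction x≈0 x≉0
  ... | no  x≉0 = proj₂ (inverse x x≉0)

  -- This is where the convention 0⁻¹ = 0 enters; it gives the zero vector the ratio 0.
  x≈0⇒y/x≈0 : ∀ {x y} → x ≈ 0# → y / x ≈ 0#
  x≈0⇒y/x≈0 {x} x≈0 with x ≟ 0#
  ... | yes _   = zeroʳ _
  ... | no  x≉0 = contradiction x≈0 x≉0

  *-/-cancel : ∀ {x y} → ¬ y ≈ 0# → y * (x / y) ≈ x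
  *-/-cancel {x} {y} y≉0 = begin-equality
    y * (x * y ⁻¹)  ≈⟨ solve 3 (λ x y z → y :* (x :* z) := x :* (y :* z)) refl x y (y ⁻¹) ⟩
    x * (y * y ⁻¹)  ≈⟨ *-congˡ (⁻¹-inverseʳ y≉0) ⟩
    x * 1#          ≈⟨ *-identityʳ x ⟩
    x               ∎

  fromℕ-* : ∀ m n → fromℕ (m ℕ.* n) ≈ fromℕ m * fromℕ n
  fromℕ-* = ×1-homo-*

  fromℕ-nonneg : ∀ n → 0# ≤ fromℕ n
  fromℕ-nonneg zero    = ≤-refl
  fromℕ-nonneg (suc n) = +-nonneg 0≤1 (fromℕ-nonneg n)

  fromℕ-pos : ∀ n → 0# < fromℕ (suc n)
  fromℕ-pos n = +-pos 0<1 (fromℕ-nonneg n)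

  fromℕ-mono-≤ : ∀ {m n} → m ℕ.≤ n → fromℕ m ≤ fromℕ n
  fromℕ-mono-≤ {n = n} z≤n = fromℕ-nonneg n
  fromℕ-mono-≤ (s≤s m≤n)     = +-monoʳ-≤ 1# (fromℕ-mono-≤ m≤n)

  fromℕ-mono-< : ∀ {m n} → m ℕ.< n → fromℕ m < fromℕ n
  fromℕ-mono-< {m} {n} m<n = begin-strict
    fromℕ m        <⟨ x<x+d _ 0<1 ⟩
    fromℕ m + 1#   ≈⟨ +-comm _ _ ⟩
    fromℕ (suc m)  ≤⟨ fromℕ-mono-≤ m<n ⟩
    fromℕ n        ∎

  -- `fromℕ` unfolds to a nested sum of ones that ends in `0#`, and the polynomials given to the
  -- solver repeat exactly that shape.
  1*x≈x : ∀ x → fromℕ 1 * x ≈ x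
  1*x≈x = solve 1 (λ x → (con 1 :+ con 0) :* x := x) refl

  2*x≈x+x : ∀ x → fromℕ 2 * x ≈ x + x
  2*x≈x+x = solve 1 (λ x → (con 1 :+ (con 1 :+ con 0)) :* x := x :+ x) refl

  ∑-mono-≤ : ∀ {n} {f g : Vector Carrier n} → (∀ i → f i ≤ g i) → ∑ f ≤ ∑ g
  ∑-mono-≤ {zero}  f≤g = ≤-refl
  ∑-mono-≤ {suc n} f≤g = +-mono-≤ (f≤g zero) (∑-mono-≤ (f≤g ∘ suc))

  ∑-nonneg : ∀ {n} {f : Vector Carrier n} → (∀ i → 0# ≤ f i) → 0# ≤ ∑ f
  ∑-nonneg {zero}  0≤f = ≤-refl
  ∑-nonneg {suc n} 0≤f = +-nonneg (0≤f zero) (∑-nonneg (0≤f ∘ suc))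

  term≤∑ : ∀ {n} {f : Vector Carrier n} → (∀ i → 0# ≤ f i) → ∀ i → f i ≤ ∑ f
  term≤∑ {suc n} {f} 0≤f i = begin
    f i                                  ≤⟨ x≤x+d _ (∑-nonneg (λ j → 0≤f (Fin.punchIn i j))) ⟩
    f i + ∑ (λ j → f (Fin.punchIn i j))  ≈⟨ sum-remove f ⟨
    ∑ f                                  ∎

  ∑-const : ∀ n x → ∑ {n} (λ _ → x) ≈ fromℕ n * x
  ∑-const n x = begin-equality
    ∑ {n} (λ _ → x)       ≈⟨ sum-cong-≋ {n} (λ _ → *-identityˡ x) ⟨
    ∑ {n} (λ _ → 1# * x)  ≈⟨ *-distribʳ-sum {n} x (λ _ → 1#) ⟨
    ∑ {n} (λ _ → 1#) * x  ≈⟨ *-congʳ (sum-replicate n) ⟩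
    fromℕ n * x           ∎

  𝟙 : ∀ {P : Set} → Dec P → Carrier
  𝟙 P? = if does P? then 1# else 0#

  𝟙-yes : ∀ {P : Set} (P? : Dec P) → P → 𝟙 P? ≈ 1#
  𝟙-yes (yes _) _ = refl
  𝟙-yes (no ¬p) p = contradiction p ¬p

  𝟙-no : ∀ {P : Set} (P? : Dec P) → ¬ P → 𝟙 P? ≈ 0#
  𝟙-no (yes p) ¬p = contradiction p ¬p
  𝟙-no (no _)  _  = refl

  -- Applied to `i ≡ j`, `Next i j` and `Next j i`, this evaluates a row of the identity matrix, of
  -- the cyclic shift and of its transpose on a vector.
  ∑-unique : ∀ {n} {P : Fin n → Set} (P? : ∀ j → Dec (P j)) {k} → P k → (∀ {j} → P j → j ≡ k) →
             ∀ (f : Vector Carrier n) → ∑ (λ j → 𝟙 (P? j) * f j) ≈ f k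
  ∑-unique {suc n} P? {k} pk unique f = begin-equality
    ∑ (λ j → 𝟙 (P? j) * f j)
      ≈⟨ sum-remove {i = k} (λ j → 𝟙 (P? j) * f j) ⟩
    𝟙 (P? k) * f k + ∑ (λ j → 𝟙 (P? (Fin.punchIn k j)) * f (Fin.punchIn k j))
      ≈⟨ +-cong (trans (*-congʳ (𝟙-yes (P? k) pk)) (*-identityˡ _))
                (trans (sum-cong-≋ (λ j → trans
                         (*-congʳ (𝟙-no (P? (Fin.punchIn k j)) (λ p → Fin.punchInᵢ≢i k j (unique p))))
                         (zeroˡ _)))
                       (sum-replicate-zero n)) ⟩
    f k + 0#  ≈⟨ +-identityʳ _ ⟩
    f k       ∎

  maximum-attained : ∀ {m} (f : Fin (suc m) → Carrier) → ∃ λ k → ∀ i → f i ≤ f k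
  maximum-attained {m} f = argmax f zero (List.allFin (suc m)) ,
    λ i → All.lookup (f[xs]≤f[argmax] {f = f} zero (List.allFin (suc m))) (∈-allFin i)
    where open Extrema totalOrder

  minimum-attained : ∀ {m} (f : Fin (suc m) → Carrier) → ∃ λ k → ∀ i → f k ≤ f i
  minimum-attained {m} f = argmin f zero (List.allFin (suc m)) ,
    λ i → All.lookup (f[argmin]≤f[xs] {f = f} zero (List.allFin (suc m))) (∈-allFin i)
    where open Extrema totalOrder

  ∈Θ-trans : ∀ {f g h} → f ∈Θ g → g ∈Θ h → f ∈Θ h
  ∈Θ-trans {f} {g} {h} (c , C , 0<c , 0<C , N , fg) (d , D , 0<d , 0<D , M , gh) =
    c * d , C * D , *-pos 0<c 0<d , *-pos 0<C 0<D , N ℕ.⊔ M , λ n N⊔M≤n →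
      let _    , cg≤f , f≤Cg = fg n (ℕ.m⊔n≤o⇒m≤o N M N⊔M≤n)
          0≤dh , dh≤g , g≤Dh = gh n (ℕ.m⊔n≤o⇒n≤o N M N⊔M≤n)
      in (begin
           0#             ≤⟨ *-nonneg (inj₁ 0<c) 0≤dh ⟩
           c * (d * h n)  ≈⟨ *-assoc c d (h n) ⟨
           c * d * h n    ∎)
       , (begin
           c * d * h n    ≈⟨ *-assoc c d (h n) ⟩
           c * (d * h n)  ≤⟨ *-monoʳ-≤ (inj₁ 0<c) dh≤g ⟩
           c * g n        ≤⟨ cg≤f ⟩
           f n            ∎)
       , (begin
           f n            ≤⟨ f≤Cg ⟩
           C * g n        ≤⟨ *-monoʳ-≤ (inj₁ 0<C) g≤Dh ⟩
           C * (D * h n)  ≈⟨ *-assoc C D (h n) ⟨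
           C * D * h n    ∎)

-- Expectation under independent Bernoulli experiments.

module Expectation (ℝ : RealNumbers) where

  open Eigensign ℝ hiding (zero)
  open RealProperties ℝ
  open OrderedField ℝ
  open import Algebra.Properties.Semiring.Sum semiring using (sum-cong-≋)
  open import Algebra.Solver.Ring.NaturalCoefficients.Default commutativeSemiring
    using (solve; _:=_; _:+_; _:*_; con)
  open SPOReasoning strictPartialOrder

  -- The fold in the definition of `𝔼`, freed from the particular list so that induction over lists
  -- applies.
  sumOver : ∀ {X : Set} → (X → Carrier) → List X → Carrier
  sumOver f xs = List.foldr _+_ 0# (List.map f xs)

  sumOver-++ : ∀ {X : Set} (f : X → Carrier) xs ys → sumOver f (xs ++ ys) ≈ sumOver f xs + sumOver f ys
  sumOver-++ f []       ys = sym (+-identityˡ _)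
  sumOver-++ f (x ∷ xs) ys = trans (+-congˡ (sumOver-++ f xs ys)) (sym (+-assoc _ _ _))

  sumOver-map : ∀ {X Y : Set} (f : Y → Carrier) (g : X → Y) xs → sumOver f (List.map g xs) ≈ sumOver (f ∘ g) xs
  sumOver-map f g xs = reflexive (≡.cong (List.foldr _+_ 0#) (≡.sym (List.map-∘ xs)))

  sumOver-* : ∀ {X : Set} {f g : X → Carrier} {c} → (∀ x → f x ≈ c * g x) →
              ∀ xs → sumOver f xs ≈ c * sumOver g xs
  sumOver-* f≈cg []       = sym (zeroʳ _)
  sumOver-* f≈cg (x ∷ xs) = trans (+-cong (f≈cg x) (sumOver-* f≈cg xs)) (sym (distribˡ _ _ _))

  sumOver-+ : ∀ {X : Set} {f g h : X → Carrier} → (∀ x → f x ≈ g x + h x) →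
              ∀ xs → sumOver f xs ≈ sumOver g xs + sumOver h xs
  sumOver-+ f≈g+h []       = sym (+-identityˡ _)
  sumOver-+ {f = f} {g} {h} f≈g+h (x ∷ xs) = begin-equality
    f x + sumOver f xs                                ≈⟨ +-cong (f≈g+h x) (sumOver-+ f≈g+h xs) ⟩
    (g x + h x) + (sumOver g xs + sumOver h xs)
      ≈⟨ solve 4 (λ a b c d → (a :+ b) :+ (c :+ d) := (a :+ c) :+ (b :+ d)) refl _ _ _ _ ⟩
    (g x + sumOver g xs) + (h x + sumOver h xs)       ∎

  sumOver-mono-≤ : ∀ {X : Set} {f g : X → Carrier} → (∀ x → f x ≤ g x) → ∀ xs → sumOver f xs ≤ sumOver g xs
  sumOver-mono-≤ f≤g []       = ≤-refl
  sumOver-mono-≤ f≤g (x ∷ xs) = +-mono-≤ (f≤g x) (sumOver-mono-≤ f≤g xs)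

  𝔼-+ : ∀ {n} (v : Vector Carrier n) f g → 𝔼 v (λ ω → f ω + g ω) ≈ 𝔼 v f + 𝔼 v g
  𝔼-+ {n} v f g =
    sumOver-+ (λ ω → distribˡ (probability v ω) (f ω) (g ω)) (outcomes n)

  -- Conditioning on the first experiment. The recursion of `outcomes` splits the sum by the first
  -- entry, and the product in `probability` computes to that entry's factor times the rest, so only
  -- associativity remains.
  𝔼-suc : ∀ {n} (v : Vector Carrier (suc n)) f →
          𝔼 v f ≈ ∣ v zero ∣ * 𝔼 (v ∘ suc) (f ∘ (true Vec.∷_)) +
                  (1# - ∣ v zero ∣) * 𝔼 (v ∘ suc) (f ∘ (false Vec.∷_))
  𝔼-suc {n} v f = begin-equality
    𝔼 v f
      ≈⟨ sumOver-++ F (List.map (true Vec.∷_) (outcomes n)) (List.map (false Vec.∷_) (outcomes n)) ⟩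
    sumOver F (List.map (true Vec.∷_) (outcomes n)) + sumOver F (List.map (false Vec.∷_) (outcomes n))
      ≈⟨ +-cong (sumOver-map F (true Vec.∷_) (outcomes n)) (sumOver-map F (false Vec.∷_) (outcomes n)) ⟩
    sumOver (F ∘ (true Vec.∷_)) (outcomes n) + sumOver (F ∘ (false Vec.∷_)) (outcomes n)
      ≈⟨ +-cong (sumOver-* (λ _ → *-assoc _ _ _) (outcomes n)) (sumOver-* (λ _ → *-assoc _ _ _) (outcomes n)) ⟩
    ∣ v zero ∣ * 𝔼 (v ∘ suc) (f ∘ (true Vec.∷_)) + (1# - ∣ v zero ∣) * 𝔼 (v ∘ suc) (f ∘ (false Vec.∷_)) ∎
    where
    F : Vec Bool (suc n) → Carrier
    F ω = probability v ω * f ω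

  p+[1-p]≈1 : ∀ p → p + (1# - p) ≈ 1#
  p+[1-p]≈1 p = begin-equality
    p + (1# + - p)  ≈⟨ solve 3 (λ p o q → p :+ (o :+ q) := o :+ (p :+ q)) refl p 1# (- p) ⟩
    1# + (p + - p)  ≈⟨ +-congˡ (-‿inverseʳ p) ⟩
    1# + 0#         ≈⟨ +-identityʳ 1# ⟩
    1#              ∎

  𝔼-const : ∀ {n} (v : Vector Carrier n) c → 𝔼 v (λ _ → c) ≈ c
  𝔼-const {zero}  v c = trans (+-identityʳ _) (*-identityˡ c)
  𝔼-const {suc n} v c = begin-equality
    𝔼 v (λ _ → c)
      ≈⟨ 𝔼-suc v _ ⟩
    ∣ v zero ∣ * 𝔼 (v ∘ suc) (λ _ → c) + (1# - ∣ v zero ∣) * 𝔼 (v ∘ suc) (λ _ → c)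
      ≈⟨ distribʳ _ _ _ ⟨
    (∣ v zero ∣ + (1# - ∣ v zero ∣)) * 𝔼 (v ∘ suc) (λ _ → c)
      ≈⟨ *-cong (p+[1-p]≈1 _) (𝔼-const (v ∘ suc) c) ⟩
    1# * c
      ≈⟨ *-identityˡ c ⟩
    c ∎

  successes : ∀ {n} → Vec Bool n → Carrier
  successes ω = ∑ λ i → if Vec.lookup ω i then 1# else 0#

  -- Induction by conditioning: `successes` on a longer vector computes to the first indicator plus
  -- the count on the rest, so with s the sum over the remaining entries the two branches give p(1 +
  -- s) + (1 - p)s = p + s.
  𝔼-successes : ∀ {n} (v : Vector Carrier n) → 𝔼 v successes ≈ ∑ (λ i → ∣ v i ∣)
  𝔼-successes {zero}  v = trans (+-identityʳ _) (*-identityˡ 0#)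
  𝔼-successes {suc n} v = begin-equality
    𝔼 v successes
      ≈⟨ 𝔼-suc v successes ⟩
    p * 𝔼 v′ (λ ω → 1# + successes ω) + (1# - p) * 𝔼 v′ (λ ω → 0# + successes ω)
      ≈⟨ +-cong (*-congˡ (shift 1#)) (*-congˡ (shift 0#)) ⟩
    p * (1# + ∑ (λ i → ∣ v′ i ∣)) + (1# - p) * (0# + ∑ (λ i → ∣ v′ i ∣))
      ≈⟨ solve 3 (λ p q s → p :* (con 1 :+ s) :+ q :* (con 0 :+ s) := p :+ (p :+ q) :* s) refl _ _ _ ⟩
    p + (p + (1# - p)) * ∑ (λ i → ∣ v′ i ∣)
      ≈⟨ +-congˡ (trans (*-congʳ (p+[1-p]≈1 p)) (*-identityˡ _)) ⟩
    p + ∑ (λ i → ∣ v′ i ∣) ∎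
    where
    p = ∣ v zero ∣
    v′ = v ∘ suc
    shift : ∀ c → 𝔼 v′ (λ ω → c + successes ω) ≈ c + ∑ (λ i → ∣ v′ i ∣)
    shift c = trans (𝔼-+ v′ (λ _ → c) successes) (+-cong (𝔼-const v′ c) (𝔼-successes v′))

  probability-nonneg : ∀ {n} (v : Vector Carrier n) → (∀ i → ∣ v i ∣ ≤ 1#) → ∀ ω → 0# ≤ probability v ω
  probability-nonneg {zero}  v ∣v∣≤1 _ = 0≤1
  probability-nonneg {suc n} v ∣v∣≤1 (true  Vec.∷ ω) =
    *-nonneg (∣x∣-nonneg (v zero)) (probability-nonneg (v ∘ suc) (∣v∣≤1 ∘ suc) ω)
  probability-nonneg {suc n} v ∣v∣≤1 (false Vec.∷ ω) =
    *-nonneg (+-cancelʳ-≤ ∣ v zero ∣ (begin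
      0# + ∣ v zero ∣                  ≈⟨ +-identityˡ _ ⟩
      ∣ v zero ∣                       ≤⟨ ∣v∣≤1 zero ⟩
      1#                               ≈⟨ p+[1-p]≈1 _ ⟨
      ∣ v zero ∣ + (1# - ∣ v zero ∣)   ≈⟨ +-comm _ _ ⟩
      (1# - ∣ v zero ∣) + ∣ v zero ∣   ∎))
      (probability-nonneg (v ∘ suc) (∣v∣≤1 ∘ suc) ω)

  𝔼-mono-≤ : ∀ {n} (v : Vector Carrier n) → (∀ i → ∣ v i ∣ ≤ 1#) →
             ∀ {f g} → (∀ ω → f ω ≤ g ω) → 𝔼 v f ≤ 𝔼 v g
  𝔼-mono-≤ {n} v ∣v∣≤1 f≤g =
    sumOver-mono-≤ (λ ω → *-monoʳ-≤ (probability-nonneg v ∣v∣≤1 ω) (f≤g ω)) (outcomes n)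

  -- This identifies xᵀx with |S|. A success at a zero entry of v would be counted although `sgn`
  -- returns 0 there; every other success contributes (±1)² = 1.
  output-square : ∀ {n} {v : Vector Carrier n} → (∀ i → ¬ v i ≈ 0#) →
                  ∀ ω → output v ω · output v ω ≈ successes ω
  output-square {v = v} v≉0 ω = sum-cong-≋ entry
    where
    entry : ∀ i → output v ω i * output v ω i ≈ (if Vec.lookup ω i then 1# else 0#)
    entry i with Vec.lookup ω i
    ... | true  = sgn-square (v≉0 i)
    ... | false = zeroˡ 0#

-- Quadratic forms, rows and eigenvectors of the adjacency matrix.

module Network (ℝ : RealNumbers) where

  open Eigensign ℝ hiding (zero)
  open RealProperties ℝ
  open OrderedField ℝ
  open Expectation ℝ
  open import Algebra.Properties.Semiring.Sum semiring
    using (∑-distrib-+; sum-cong-≋; *-distribˡ-sum; *-distribʳ-sum)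
  open import Algebra.Solver.Ring.NaturalCoefficients.Default commutativeSemiring
    using (solve; _:=_; _:+_; _:*_; con)
  open SPOReasoning strictPartialOrder

  -- The entry condition of `IsFeasible`, stated for one number. It also covers the entries of the
  -- outputs and of adjacency matrices, and it is closed under products.
  Trit : Carrier → Set
  Trit x = x ≈ - 1# ⊎ x ≈ 0# ⊎ x ≈ 1#

  Trit-* : ∀ {x y} → Trit x → Trit y → Trit (x * y)
  Trit-* (inj₁ x≈-1) (inj₁ y≈-1) =
    inj₂ (inj₂ (trans (*-cong x≈-1 y≈-1) (trans (-x*-x≈x*x 1#) (*-identityʳ 1#))))
  Trit-* (inj₁ x≈-1) (inj₂ (inj₂ y≈1)) = inj₁ (trans (*-cong x≈-1 y≈1) (*-identityʳ (- 1#)))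
  Trit-* (inj₂ (inj₁ x≈0)) _ = inj₂ (inj₁ (trans (*-congʳ x≈0) (zeroˡ _)))
  Trit-* _ (inj₂ (inj₁ y≈0)) = inj₂ (inj₁ (trans (*-congˡ y≈0) (zeroʳ _)))
  Trit-* (inj₂ (inj₂ x≈1)) (inj₁ y≈-1) = inj₁ (trans (*-cong x≈1 y≈-1) (*-identityˡ (- 1#)))
  Trit-* (inj₂ (inj₂ x≈1)) (inj₂ (inj₂ y≈1)) = inj₂ (inj₂ (trans (*-cong x≈1 y≈1) (*-identityˡ 1#)))

  ±1-square : ∀ {x} → x ≈ - 1# ⊎ x ≈ 1# → x * x ≈ 1#
  ±1-square (inj₁ x≈-1) = trans (*-cong x≈-1 x≈-1) (trans (-x*-x≈x*x 1#) (*-identityʳ 1#))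
  ±1-square (inj₂ x≈1)  = trans (*-cong x≈1 x≈1) (*-identityʳ 1#)

  -1≤1 : - 1# ≤ 1#
  -1≤1 = +-cancelʳ-≤ 1# (begin
    - 1# + 1#  ≈⟨ -‿inverseˡ 1# ⟩
    0#         ≤⟨ +-nonneg 0≤1 0≤1 ⟩
    1# + 1#    ∎)

  Trit-≤1 : ∀ {x} → Trit x → x ≤ 1#
  Trit-≤1 (inj₁ x≈-1)      = ≤-trans (inj₂ x≈-1) -1≤1
  Trit-≤1 (inj₂ (inj₁ x≈0)) = ≤-trans (inj₂ x≈0) 0≤1
  Trit-≤1 (inj₂ (inj₂ x≈1)) = inj₂ x≈1

  -- For x = ±1 the right-hand side is 1, which bounds every trit; for x = 0 both sides vanish.
  -- Bounding by x² and not by 1 keeps vertices outside the support out of the count.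
  Trit-*-≤ : ∀ {x y} → Trit x → Trit y → x * y ≤ x * x
  Trit-*-≤ tx@(inj₁ x≈-1) ty = ≤-trans (Trit-≤1 (Trit-* tx ty)) (inj₂ (sym (±1-square (inj₁ x≈-1))))
  Trit-*-≤ (inj₂ (inj₁ x≈0)) ty = inj₂ (trans (x*≈0 _) (sym (x*≈0 _)))
    where
    x*≈0 : ∀ z → _ * z ≈ 0#
    x*≈0 z = trans (*-congʳ x≈0) (zeroˡ z)
  Trit-*-≤ tx@(inj₂ (inj₂ x≈1)) ty = ≤-trans (Trit-≤1 (Trit-* tx ty)) (inj₂ (sym (±1-square (inj₂ x≈1))))

  sgn-Trit : ∀ x → Trit (sgn x)
  sgn-Trit x with compare x 0#
  ... | tri< _ _ _ = inj₁ refl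
  ... | tri≈ _ _ _ = inj₂ (inj₁ refl)
  ... | tri> _ _ _ = inj₂ (inj₂ refl)

  output-Trit : ∀ {n} (v : Vector Carrier n) ω i → Trit (output v ω i)
  output-Trit v ω i with Vec.lookup ω i
  ... | true  = sgn-Trit (v i)
  ... | false = inj₂ (inj₁ refl)

  adjacency-Trit : ∀ {n} (H : SignedNetwork n) i j → Trit (adjacency H i j)
  adjacency-Trit H i j with SignedNetwork.edge H i j
  ... | just Sign.+ = inj₂ (inj₂ refl)
  ... | just Sign.- = inj₁ refl
  ... | nothing     = inj₂ (inj₁ refl)

  Trit-square≤1 : ∀ {x} → Trit x → x * x ≤ 1#
  Trit-square≤1 t = Trit-≤1 (Trit-* t t)

  ∑*∑ : ∀ {m n} (f : Vector Carrier m) (g : Vector Carrier n) → ∑ f * ∑ g ≈ ∑ (λ i → ∑ (λ j → f i * g j))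
  ∑*∑ f g = trans (*-distribʳ-sum (∑ g) f) (sum-cong-≋ (λ i → *-distribˡ-sum (f i) g))

  -- Every ordered pair of vertices in the support of y contributes at most 1, and all other pairs
  -- contribute 0.
  quadratic-form-≤ : ∀ {n} (H : SignedNetwork n) {y} → (∀ i → Trit (y i)) →
                     y · (adjacency H *ᵥ y) ≤ (y · y) * (y · y)
  quadratic-form-≤ H {y} ty = begin
    ∑ (λ i → y i * ∑ (λ j → A i j * y j))
      ≈⟨ sum-cong-≋ (λ i → *-distribˡ-sum (y i) (λ j → A i j * y j)) ⟩
    ∑ (λ i → ∑ (λ j → y i * (A i j * y j)))
      ≤⟨ ∑-mono-≤ (λ i → ∑-mono-≤ (λ j → entry i j)) ⟩
    ∑ (λ i → ∑ (λ j → y i * y i * (y j * y j)))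
      ≈⟨ ∑*∑ (λ i → y i * y i) (λ j → y j * y j) ⟨
    (y · y) * (y · y) ∎
    where
    A = adjacency H
    entry : ∀ i j → y i * (A i j * y j) ≤ y i * y i * (y j * y j)
    entry i j = begin
      y i * (A i j * y j)        ≈⟨ solve 3 (λ a b c → a :* (b :* c) := (a :* c) :* b) refl _ _ _ ⟩
      y i * y j * A i j          ≤⟨ Trit-*-≤ (Trit-* (ty i) (ty j)) (adjacency-Trit H i j) ⟩
      y i * y j * (y i * y j)    ≈⟨ solve 2 (λ a b → (a :* b) :* (a :* b) := (a :* a) :* (b :* b)) refl _ _ ⟩
      y i * y i * (y j * y j)    ∎

  y·y-nonneg : ∀ {n} (y : Vector Carrier n) → 0# ≤ y · y
  y·y-nonneg y = ∑-nonneg (λ i → square-nonneg (y i))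

  ratio-≤ : ∀ {n} (H : SignedNetwork n) {y} → (∀ i → Trit (y i)) → ratio (adjacency H) y ≤ y · y
  ratio-≤ H {y} ty with y·y-nonneg y
  -- The default value of the ratio makes both sides 0 here.
  ... | inj₂ 0≈k = ≤-trans (inj₂ (x≈0⇒y/x≈0 (sym 0≈k))) (inj₂ 0≈k)
  ... | inj₁ 0<k = *-cancelˡ-≤ 0<k (begin
    (y · y) * ratio (adjacency H) y  ≈⟨ *-/-cancel (pos⇒≉0 0<k) ⟩
    y · (adjacency H *ᵥ y)           ≤⟨ quadratic-form-≤ H ty ⟩
    (y · y) * (y · y)                ∎)

  -- C is written as the shift plus its transpose, so that each summand has a single nonzero entry
  -- per row. On a cycle edge exactly one of the two indicators is 1, and -1 + 1 + 1 = 1 explains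
  -- the coefficient 2 of C.
  adjacency-G : ∀ {n} → 2 ℕ.< n → ∀ (i j : Fin n) →
    adjacency (G n) i j + (𝟙 (i Fin.≟ j) + ((𝟙 (next? i j) + 𝟙 (next? j i)) + (𝟙 (next? i j) + 𝟙 (next? j i)))) ≈ 1#
  -- These are the tests made by `edge`, so the matrix entry reduces to a constant in each case.
  adjacency-G 2<n i j with i Fin.≟ j | cycleEdge? i j
  ... | yes ≡.refl | _ = trans
    (+-congˡ (+-congˡ (+-cong (+-cong n₀ n₀) (+-cong n₀ n₀))))
    (solve 0 (con 0 :+ (con 1 :+ ((con 0 :+ con 0) :+ (con 0 :+ con 0))) := con 1) refl)
    where
    n₀ : 𝟙 (next? i i) ≈ 0#
    n₀ = 𝟙-no (next? i i) (Next-irrefl 2<n)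
  ... | no _ | yes (inj₁ p) = trans
    (+-congˡ (+-congˡ (+-cong (+-cong n₁ n₀) (+-cong n₁ n₀))))
    -- The solver sees -1 as a variable; its cancellation against 1 is done separately.
    (trans (solve 2 (λ a o → a :+ (con 0 :+ ((o :+ con 0) :+ (o :+ con 0))) := (a :+ o) :+ o) refl (- 1#) 1#)
           (trans (+-congʳ (-‿inverseˡ 1#)) (+-identityˡ 1#)))
    where
    n₁ : 𝟙 (next? i j) ≈ 1#
    n₁ = 𝟙-yes (next? i j) p
    n₀ : 𝟙 (next? j i) ≈ 0#
    n₀ = 𝟙-no (next? j i) (Next-asym 2<n p)
  ... | no _ | yes (inj₂ p) = trans
    (+-congˡ (+-congˡ (+-cong (+-cong n₀ n₁) (+-cong n₀ n₁))))
    (trans (solve 2 (λ a o → a :+ (con 0 :+ ((con 0 :+ o) :+ (con 0 :+ o))) := (a :+ o) :+ o) refl (- 1#) 1#)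
           (trans (+-congʳ (-‿inverseˡ 1#)) (+-identityˡ 1#)))
    where
    n₁ : 𝟙 (next? j i) ≈ 1#
    n₁ = 𝟙-yes (next? j i) p
    n₀ : 𝟙 (next? i j) ≈ 0#
    n₀ = 𝟙-no (next? i j) (Next-asym 2<n p)
  ... | no _ | no ¬p = trans
    (+-congˡ (+-congˡ (+-cong (+-cong n₀ n₀′) (+-cong n₀ n₀′))))
    (solve 1 (λ o → o :+ (con 0 :+ ((con 0 :+ con 0) :+ (con 0 :+ con 0))) := o) refl 1#)
    where
    n₀ : 𝟙 (next? i j) ≈ 0#
    n₀ = 𝟙-no (next? i j) (¬p ∘ inj₁)
    n₀′ : 𝟙 (next? j i) ≈ 0#
    n₀′ = 𝟙-no (next? j i) (¬p ∘ inj₂)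

  neighbours : ∀ {m} → Vector Carrier (suc m) → Vector Carrier (suc m)
  neighbours u i = u (proj₁ (next i)) + u (proj₁ (previous i))

  -- The right-hand side does not depend on i, so any two rows can be compared. It is applied to the
  -- all-ones vector for the eigenvalue n - 5, to an eigenvector for its constancy, and to trit
  -- vectors for the lower bound on the ratio.
  row-sum : ∀ {m} → 2 ℕ.< suc m → ∀ (u : Vector Carrier (suc m)) i →
            (adjacency (G (suc m)) *ᵥ u) i + (u i + (neighbours u i + neighbours u i)) ≈ ∑ u
  row-sum {m} 2<n u i = begin-equality
    ∑ a + (u i + (neighbours u i + neighbours u i))
      ≈⟨ +-congˡ (+-cong ∑d (+-cong ∑N ∑N)) ⟨
    ∑ a + (∑ d + (∑ (λ j → s j + p j) + ∑ (λ j → s j + p j)))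
      ≈⟨ +-congˡ (+-congˡ (∑-distrib-+ (λ j → s j + p j) (λ j → s j + p j))) ⟨
    ∑ a + (∑ d + ∑ (λ j → (s j + p j) + (s j + p j)))
      ≈⟨ +-congˡ (∑-distrib-+ d (λ j → (s j + p j) + (s j + p j))) ⟨
    ∑ a + ∑ (λ j → d j + ((s j + p j) + (s j + p j)))
      ≈⟨ ∑-distrib-+ a (λ j → d j + ((s j + p j) + (s j + p j))) ⟨
    ∑ (λ j → a j + (d j + ((s j + p j) + (s j + p j))))
      ≈⟨ sum-cong-≋ entry ⟩
    ∑ u ∎
    where
    a d s p : Vector Carrier (suc m)
    a j = adjacency (G (suc m)) i j * u j
    d j = 𝟙 (i Fin.≟ j) * u j
    s j = 𝟙 (next? i j) * u j
    p j = 𝟙 (next? j i) * u j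
    ∑d : ∑ d ≈ u i
    ∑d = ∑-unique (i Fin.≟_) ≡.refl ≡.sym u
    ∑N : ∑ (λ j → s j + p j) ≈ neighbours u i
    ∑N = trans (∑-distrib-+ s p) (+-cong
      (∑-unique (next? i) (proj₂ (next i)) (λ q → Next-functional q (proj₂ (next i))) u)
      (∑-unique (λ j → next? j i) (proj₂ (previous i)) (λ q → Next-injective q (proj₂ (previous i))) u))
    entry : ∀ j → a j + (d j + ((s j + p j) + (s j + p j))) ≈ u j
    entry j = trans
      (solve 5 (λ a d s p u → a :* u :+ (d :* u :+ ((s :* u :+ p :* u) :+ (s :* u :+ p :* u)))
                           := (a :+ (d :+ ((s :+ p) :+ (s :+ p)))) :* u) refl _ _ _ _ _)
      (trans (*-congʳ (adjacency-G 2<n i j)) (*-identityˡ _))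

  5*x≈ : ∀ x → fromℕ 5 * x ≈ x + ((x + x) + (x + x))
  5*x≈ = solve 1 (λ x → (con 1 :+ (con 1 :+ (con 1 :+ (con 1 :+ (con 1 :+ con 0))))) :* x
                     := x :+ ((x :+ x) :+ (x :+ x))) refl

  -- Multiply row i of `row-sum` by y i and add over i. The terms other than those of A amount to
  -- yᵢ² plus twice the products of yᵢ with its two neighbours; each product is at most yᵢ², which
  -- gives 5yᵢ² in total.
  [∑y]²≤ : ∀ {m} → 2 ℕ.< suc m → ∀ {y : Vector Carrier (suc m)} → (∀ i → Trit (y i)) →
           ∑ y * ∑ y ≤ y · (adjacency (G (suc m)) *ᵥ y) + fromℕ 5 * (y · y)
  [∑y]²≤ {m} 2<n {y} ty = begin
    ∑ y * ∑ y
      ≈⟨ *-distribʳ-sum (∑ y) y ⟩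
    ∑ (λ i → y i * ∑ y)
      ≤⟨ ∑-mono-≤ row ⟩
    ∑ (λ i → y i * (A *ᵥ y) i + fromℕ 5 * (y i * y i))
      ≈⟨ ∑-distrib-+ (λ i → y i * (A *ᵥ y) i) (λ i → fromℕ 5 * (y i * y i)) ⟩
    y · (A *ᵥ y) + ∑ (λ i → fromℕ 5 * (y i * y i))
      ≈⟨ +-congˡ (*-distribˡ-sum (fromℕ 5) (λ i → y i * y i)) ⟨
    y · (A *ᵥ y) + fromℕ 5 * (y · y) ∎
    where
    A = adjacency (G (suc m))
    row : ∀ i → y i * ∑ y ≤ y i * (A *ᵥ y) i + fromℕ 5 * (y i * y i)
    row i = begin
      y i * ∑ y
        ≈⟨ *-congˡ (row-sum 2<n y i) ⟨
      y i * ((A *ᵥ y) i + (y i + (neighbours y i + neighbours y i)))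
        ≈⟨ solve 4 (λ y b s p → y :* (b :+ (y :+ ((s :+ p) :+ (s :+ p))))
              := y :* b :+ (y :* y :+ ((y :* s :+ y :* p) :+ (y :* s :+ y :* p)))) refl _ _ _ _ ⟩
      y i * (A *ᵥ y) i + (y i * y i + ((y i * s + y i * p) + (y i * s + y i * p)))
        ≤⟨ +-monoʳ-≤ _ (+-monoʳ-≤ _ (+-mono-≤ sp sp)) ⟩
      y i * (A *ᵥ y) i + (y i * y i + ((y i * y i + y i * y i) + (y i * y i + y i * y i)))
        ≈⟨ +-congˡ (5*x≈ (y i * y i)) ⟨
      y i * (A *ᵥ y) i + fromℕ 5 * (y i * y i) ∎
      where
      s = y (proj₁ (next i))
      p = y (proj₁ (previous i))
      sp : y i * s + y i * p ≤ y i * y i + y i * y i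
      sp = +-mono-≤ (Trit-*-≤ (ty i) (ty _)) (Trit-*-≤ (ty i) (ty _))

  -- The hypotheses on σ say that y is σ times the indicator of its support, with σ = ±1. Then y·y =
  -- σ∑y, so (∑y)² = (y·y)², and `[∑y]²≤` can be divided by y·y.
  ≤-ratio : ∀ {m} → 2 ℕ.< suc m → ∀ {y : Vector Carrier (suc m)} → (∀ i → Trit (y i)) →
            ∀ {σ} → σ * σ ≈ 1# → (∀ i → y i * y i ≈ σ * y i) →
            y · y ≤ ratio (adjacency (G (suc m))) y + fromℕ 5
  ≤-ratio {m} 2<n {y} ty {σ} σ²≈1 y²≈σy with y·y-nonneg y
  ... | inj₂ 0≈k = begin
    y · y                 ≈⟨ 0≈k ⟨
    0#                    ≤⟨ fromℕ-nonneg 5 ⟩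
    fromℕ 5               ≈⟨ +-identityˡ _ ⟨
    0# + fromℕ 5          ≈⟨ +-congʳ (x≈0⇒y/x≈0 (sym 0≈k)) ⟨
    ratio A y + fromℕ 5   ∎
    where A = adjacency (G (suc m))
  ... | inj₁ 0<k = *-cancelˡ-≤ 0<k (begin
    (y · y) * (y · y)                  ≈⟨ *-cong k≈σ∑ k≈σ∑ ⟩
    (σ * ∑ y) * (σ * ∑ y)              ≈⟨ solve 2 (λ a b → (a :* b) :* (a :* b) := (a :* a) :* (b :* b)) refl _ _ ⟩
    (σ * σ) * (∑ y * ∑ y)              ≈⟨ trans (*-congʳ σ²≈1) (*-identityˡ _) ⟩
    ∑ y * ∑ y                          ≤⟨ [∑y]²≤ 2<n ty ⟩
    y · (A *ᵥ y) + fromℕ 5 * (y · y)   ≈⟨ +-cong (*-/-cancel (pos⇒≉0 0<k)) (*-comm (y · y) (fromℕ 5)) ⟨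
    (y · y) * ratio A y + (y · y) * fromℕ 5  ≈⟨ distribˡ _ _ _ ⟨
    (y · y) * (ratio A y + fromℕ 5)    ∎)
    where
    A = adjacency (G (suc m))
    k≈σ∑ : y · y ≈ σ * ∑ y
    k≈σ∑ = trans (sum-cong-≋ y²≈σy) (sym (*-distribˡ-sum σ y))

  n-5-eigenvalue : ∀ {m} → 2 ℕ.< suc m → IsEigenvalue (adjacency (G (suc m))) (fromℕ (suc m) - fromℕ 5)
  n-5-eigenvalue {m} 2<n = (λ _ → 1#) , (λ 1≈0 → pos⇒≉0 0<1 (1≈0 zero)) , λ i → begin-equality
    a i                            ≈⟨ +-identityʳ _ ⟨
    a i + 0#                       ≈⟨ +-congˡ (-‿inverseʳ (fromℕ 5)) ⟨
    a i + (fromℕ 5 - fromℕ 5)      ≈⟨ +-assoc _ _ _ ⟨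
    (a i + fromℕ 5) - fromℕ 5      ≈⟨ +-congʳ (+-congˡ (trans (sym (*-identityʳ _)) (5*x≈ 1#))) ⟩
    (a i + (1# + ((1# + 1#) + (1# + 1#)))) - fromℕ 5  ≈⟨ +-congʳ (row-sum 2<n (λ _ → 1#) i) ⟩
    ∑ {suc m} (λ _ → 1#) - fromℕ 5       ≈⟨ +-congʳ (trans (∑-const (suc m) 1#) (*-identityʳ _)) ⟩
    fromℕ (suc m) - fromℕ 5              ≈⟨ *-identityʳ _ ⟨
    (fromℕ (suc m) - fromℕ 5) * 1#       ∎
    where
    a : Vector Carrier (suc m)
    a = adjacency (G (suc m)) *ᵥ (λ _ → 1#)

  -- With a = max v and b = min v, the neighbours of the maximum sum to at least 2b and those of the
  -- minimum to at most 2a. As both rows equal ∑v, this yields `compared`, which says (μ - 3)(a - b)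
  -- ≤ 0.
  eigenvector-constant : ∀ {m} → 2 ℕ.< suc m → ∀ {μ v} → fromℕ 8 < μ + fromℕ 5 →
    IsEigenvector (adjacency (G (suc m))) μ v → ∀ i j → v i ≈ v j
  eigenvector-constant {m} 2<n {μ} {v} 8<μ+5 (_ , Av≈μv) i j =
    ≤-antisym (≤-trans (v≤max i) (≤-trans max≤min (min≤v j)))
              (≤-trans (v≤max j) (≤-trans max≤min (min≤v i)))
    where
    k = proj₁ (maximum-attained v)
    l = proj₁ (minimum-attained v)
    v≤max = proj₂ (maximum-attained v)
    min≤v = proj₂ (minimum-attained v)
    a = v k
    b = v l

    eq : ∀ i → μ * v i + (v i + (neighbours v i + neighbours v i)) ≈ ∑ v
    eq i = trans (+-congʳ (sym (Av≈μv i))) (row-sum 2<n v i)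

    lo : b + b ≤ neighbours v k
    lo = +-mono-≤ (min≤v _) (min≤v _)
    hi : neighbours v l ≤ a + a
    hi = +-mono-≤ (v≤max _) (v≤max _)

    compared : μ * a + (a + ((b + b) + (b + b))) ≤ μ * b + (b + ((a + a) + (a + a)))
    compared = begin
      μ * a + (a + ((b + b) + (b + b)))                        ≤⟨ +-monoʳ-≤ _ (+-monoʳ-≤ _ (+-mono-≤ lo lo)) ⟩
      μ * a + (a + (neighbours v k + neighbours v k))          ≈⟨ trans (eq k) (sym (eq l)) ⟩
      μ * b + (b + (neighbours v l + neighbours v l))          ≤⟨ +-monoʳ-≤ _ (+-monoʳ-≤ _ (+-mono-≤ hi hi)) ⟩
      μ * b + (b + ((a + a) + (a + a)))                        ∎

    e = proj₁ (difference 8<μ+5)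
    0<e = proj₁ (proj₂ (difference 8<μ+5))
    8+e≈μ+5 = proj₂ (proj₂ (difference 8<μ+5))

    collect : ∀ e x y → e * x + fromℕ 8 * (x + y) ≈ (fromℕ 8 + e) * x + fromℕ 8 * y
    collect e x y = solve 4 (λ e x y t → e :* x :+ t :* (x :+ y) := (t :+ e) :* x :+ t :* y) refl e x y (fromℕ 8)

    expand : ∀ x y → (μ + fromℕ 5) * x + fromℕ 8 * y
                   ≈ (μ * x + (x + ((y + y) + (y + y)))) + ((x + x) + (x + x) + ((y + y) + (y + y)))
    expand = solve 3 (λ m x y →
        (m :+ (con 1 :+ (con 1 :+ (con 1 :+ (con 1 :+ (con 1 :+ con 0)))))) :* x
          :+ (con 1 :+ (con 1 :+ (con 1 :+ (con 1 :+ (con 1 :+ (con 1 :+ (con 1 :+ (con 1 :+ con 0)))))))) :* y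
        := (m :* x :+ (x :+ ((y :+ y) :+ (y :+ y)))) :+ ((x :+ x) :+ (x :+ x) :+ ((y :+ y) :+ (y :+ y)))) refl μ

    -- Here e = μ - 3. Adding 4(a + b) to both sides of `compared` gives (μ + 5)a + 8b ≤ (μ + 5)b +
    -- 8a; substituting μ + 5 = 8 + e and cancelling 8(a + b) leaves ea ≤ eb.
    max≤min : a ≤ b
    max≤min = *-cancelˡ-≤ 0<e (+-cancelʳ-≤ (fromℕ 8 * (a + b)) (begin
      e * a + fromℕ 8 * (a + b)                ≈⟨ collect e a b ⟩
      (fromℕ 8 + e) * a + fromℕ 8 * b          ≈⟨ +-congʳ (*-congʳ 8+e≈μ+5) ⟩
      (μ + fromℕ 5) * a + fromℕ 8 * b          ≈⟨ expand a b ⟩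
      (μ * a + (a + ((b + b) + (b + b)))) + ((a + a) + (a + a) + ((b + b) + (b + b)))
        ≤⟨ +-monoˡ-≤ _ compared ⟩
      (μ * b + (b + ((a + a) + (a + a)))) + ((a + a) + (a + a) + ((b + b) + (b + b)))
        ≈⟨ +-congˡ (+-comm _ _) ⟩
      (μ * b + (b + ((a + a) + (a + a)))) + ((b + b) + (b + b) + ((a + a) + (a + a)))
        ≈⟨ expand b a ⟨
      (μ + fromℕ 5) * b + fromℕ 8 * a          ≈⟨ +-congʳ (*-congʳ 8+e≈μ+5) ⟨
      (fromℕ 8 + e) * b + fromℕ 8 * a          ≈⟨ collect e b a ⟨
      e * b + fromℕ 8 * (b + a)                ≈⟨ +-congˡ (*-congˡ (+-comm b a)) ⟩
      e * b + fromℕ 8 * (a + b)                ∎))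

  -- Bounds on the expected ratio and on the optimum for n > 16.

  module _ {m} (16<n : 16 ℕ.< suc m) where
    private
      n = suc m
      A = adjacency (G n)
      2<n : 2 ℕ.< n
      2<n = ℕ.≤-trans (ℕ.m≤n+m 3 14) 16<n

    module _ {v : Vector Carrier n} (top : IsUnitTopEigenvector A v) where
      private
        μ = proj₁ (proj₁ top)
        largest = proj₂ (proj₁ (proj₂ (proj₁ top)))
        eigen = proj₂ (proj₂ (proj₁ top))

      -- Maximality of the eigenvalue enters through this comparison with the explicit eigenvalue n
      -- - 5.
      n≤λ₁+5 : fromℕ n ≤ μ + fromℕ 5
      n≤λ₁+5 = begin
        fromℕ n                        ≈⟨ +-identityʳ _ ⟨
        fromℕ n + 0#                   ≈⟨ +-congˡ (-‿inverseˡ (fromℕ 5)) ⟨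
        fromℕ n + (- fromℕ 5 + fromℕ 5)  ≈⟨ +-assoc _ _ _ ⟨
        (fromℕ n - fromℕ 5) + fromℕ 5  ≤⟨ +-monoˡ-≤ _ (largest _ (n-5-eigenvalue 2<n)) ⟩
        μ + fromℕ 5                    ∎

      top-constant : ∀ i j → v i ≈ v j
      top-constant = eigenvector-constant 2<n (begin-strict
        fromℕ 8      <⟨ fromℕ-mono-< (ℕ.≤-trans (ℕ.m≤n+m 9 8) 16<n) ⟩
        fromℕ n      ≤⟨ n≤λ₁+5 ⟩
        μ + fromℕ 5  ∎) eigen

      v·v≈1 : v · v ≈ 1#
      v·v≈1 = √x≈1⇒x≈1 (y·y-nonneg v) (proj₂ top)

      ∣v∣≤1 : ∀ i → ∣ v i ∣ ≤ 1#
      ∣v∣≤1 i = square-reflects-≤ 0≤1 (begin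
        ∣ v i ∣ * ∣ v i ∣  ≈⟨ ∣x∣*∣x∣≈x*x (v i) ⟩
        v i * v i          ≤⟨ term≤∑ (λ j → square-nonneg (v j)) i ⟩
        v · v              ≈⟨ v·v≈1 ⟩
        1#                 ≈⟨ *-identityʳ 1# ⟨
        1# * 1#            ∎)

      v≉0 : ∀ i → ¬ v i ≈ 0#
      v≉0 i vᵢ≈0 = proj₁ eigen (λ j → trans (top-constant j i) vᵢ≈0)

      -- The equality case of Cauchy-Schwarz: all moduli equal p, so the square of the left-hand
      -- side is n²p² = n(v·v) = n.
      ∑∣v∣≈√n : ∑ (λ i → ∣ v i ∣) ≈ √ (fromℕ n)
      ∑∣v∣≈√n = square-injective (∑-nonneg (λ i → ∣x∣-nonneg (v i))) (√-nonneg (fromℕ n)) (begin-equality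
        ∑ (λ i → ∣ v i ∣) * ∑ (λ i → ∣ v i ∣)  ≈⟨ *-cong ∑≈ ∑≈ ⟩
        (fromℕ n * p) * (fromℕ n * p)
          ≈⟨ solve 2 (λ n p → (n :* p) :* (n :* p) := n :* (n :* (p :* p))) refl _ _ ⟩
        fromℕ n * (fromℕ n * (p * p))          ≈⟨ *-congˡ (∑-const n (p * p)) ⟨
        fromℕ n * ∑ {n} (λ _ → p * p)          ≈⟨ *-congˡ (sum-cong-≋ (λ i → square i)) ⟩
        fromℕ n * (v · v)                      ≈⟨ *-congˡ v·v≈1 ⟩
        fromℕ n * 1#                           ≈⟨ *-identityʳ _ ⟩
        fromℕ n                                ≈⟨ √-square (fromℕ-nonneg n) ⟨
        √ (fromℕ n) * √ (fromℕ n)              ∎)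
        where
        p = ∣ v zero ∣
        ∑≈ : ∑ (λ i → ∣ v i ∣) ≈ fromℕ n * p
        ∑≈ = trans (sum-cong-≋ (λ i → ∣∣-cong (top-constant i zero))) (∑-const n p)
        square : ∀ i → p * p ≈ v i * v i
        square i = trans (∣x∣*∣x∣≈x*x (v zero)) (*-cong (top-constant zero i) (top-constant zero i))

      -- All entries of v share one sign, which serves as σ in `≤-ratio`. The equation also holds at
      -- failures, where both sides are 0.
      output-sign : ∀ ω i → output v ω i * output v ω i ≈ sgn (v zero) * output v ω i
      output-sign ω i with Vec.lookup ω i
      ... | true  = *-congʳ (sgn-cong (top-constant i zero))
      ... | false = trans (zeroˡ 0#) (sym (zeroʳ _))

      𝔼-successes≈√n : 𝔼 v successes ≈ √ (fromℕ n)
      𝔼-successes≈√n = trans (𝔼-successes v) ∑∣v∣≈√n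

      expectedRatio≤√n : expectedRatio A v ≤ √ (fromℕ n)
      expectedRatio≤√n = begin
        expectedRatio A v
          ≤⟨ 𝔼-mono-≤ v ∣v∣≤1 (λ ω → ≤-trans (ratio-≤ (G n) (output-Trit v ω)) (inj₂ (output-square v≉0 ω))) ⟩
        𝔼 v successes      ≈⟨ 𝔼-successes≈√n ⟩
        √ (fromℕ n)        ∎

      √n≤expectedRatio+5 : √ (fromℕ n) ≤ expectedRatio A v + fromℕ 5
      √n≤expectedRatio+5 = begin
        √ (fromℕ n)      ≈⟨ 𝔼-successes≈√n ⟨
        𝔼 v successes
          ≤⟨ 𝔼-mono-≤ v ∣v∣≤1 (λ ω → ≤-trans (inj₂ (sym (output-square v≉0 ω)))
               (≤-ratio 2<n (output-Trit v ω) (sgn-square (v≉0 zero)) (output-sign ω))) ⟩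
        𝔼 v (λ ω → ratio A (output v ω) + fromℕ 5)
          ≈⟨ 𝔼-+ v (λ ω → ratio A (output v ω)) (λ _ → fromℕ 5) ⟩
        expectedRatio A v + 𝔼 v (λ _ → fromℕ 5)
          ≈⟨ +-congˡ (𝔼-const v (fromℕ 5)) ⟩
        expectedRatio A v + fromℕ 5 ∎

    module _ {OPT} (isOPT : IsOPT A OPT) where

      OPT≤n : OPT ≤ fromℕ n
      OPT≤n with (y , (ty , _) , ratio≈OPT) ← proj₁ isOPT = begin
        OPT            ≈⟨ ratio≈OPT ⟨
        ratio A y      ≤⟨ ratio-≤ (G n) ty ⟩
        y · y          ≤⟨ ∑-mono-≤ (λ i → Trit-square≤1 (ty i)) ⟩
        ∑ {n} (λ _ → 1#)   ≈⟨ trans (∑-const n 1#) (*-identityʳ _) ⟩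
        fromℕ n        ∎

      n≤OPT+5 : fromℕ n ≤ OPT + fromℕ 5
      n≤OPT+5 = begin
        fromℕ n                ≈⟨ trans (∑-const n (1# * 1#)) (trans (*-congˡ (*-identityʳ 1#)) (*-identityʳ _)) ⟨
        -- The all-ones vector is the indicator of the whole vertex set, with σ = 1.
        ones · ones            ≤⟨ ≤-ratio 2<n ones-Trit (*-identityʳ 1#) (λ _ → refl) ⟩
        ratio A ones + fromℕ 5 ≤⟨ +-monoˡ-≤ _ (proj₂ isOPT ones (ones-Trit , λ 1≈0 → pos⇒≉0 0<1 (1≈0 zero))) ⟩
        OPT + fromℕ 5          ∎
        where
        ones : Vector Carrier n
        ones _ = 1#
        ones-Trit : ∀ i → Trit (ones i)
        ones-Trit _ = inj₂ (inj₂ refl)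

-- From additive errors to Θ.

module Asymptotics (ℝ : RealNumbers) where

  open Eigensign ℝ hiding (zero)
  open RealProperties ℝ
  open OrderedField ℝ
  open Network ℝ
  open SPOReasoning strictPartialOrder

  half : Carrier
  half = proj₁ (pos-inverse (fromℕ-pos 1))

  0<half : 0# < half
  0<half = proj₁ (proj₂ (pos-inverse (fromℕ-pos 1)))

  2*half≈1 : fromℕ 2 * half ≈ 1#
  2*half≈1 = proj₂ (proj₂ (pos-inverse (fromℕ-pos 1)))

  2*[half*x]≈x : ∀ x → fromℕ 2 * (half * x) ≈ x
  2*[half*x]≈x x = trans (sym (*-assoc _ _ _)) (trans (*-congʳ 2*half≈1) (*-identityˡ x))

  -- Turns an additive loss c into a factor 2: 2x ≤ 2y + 2c ≤ 2y + x. It is used with c = 5, for x =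
  -- √n and for x = n, and so asks for x ≥ 10.
  double≤ : ∀ {x y c} → x ≤ y + c → fromℕ 2 * c ≤ x → x ≤ fromℕ 2 * y
  double≤ {x} {y} {c} x≤y+c 2c≤x = +-cancelʳ-≤ x (begin
    x + x                        ≤⟨ +-mono-≤ x≤y+c x≤y+c ⟩
    (y + c) + (y + c)            ≈⟨ 2*x≈x+x (y + c) ⟨
    fromℕ 2 * (y + c)            ≈⟨ distribˡ _ _ _ ⟩
    fromℕ 2 * y + fromℕ 2 * c    ≤⟨ +-monoʳ-≤ _ 2c≤x ⟩
    fromℕ 2 * y + x              ∎)

  fromℕ10≈ : fromℕ 2 * fromℕ 5 ≈ fromℕ 10
  fromℕ10≈ = sym (fromℕ-* 2 5)

  10≤√n : ∀ {n} → 100 ℕ.≤ n → fromℕ 10 ≤ √ (fromℕ n)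
  10≤√n {n} 100≤n = square-reflects-≤ (√-nonneg (fromℕ n)) (begin
    fromℕ 10 * fromℕ 10        ≈⟨ fromℕ-* 10 10 ⟨
    fromℕ 100                  ≤⟨ fromℕ-mono-≤ 100≤n ⟩
    fromℕ n                    ≈⟨ √-square (fromℕ-nonneg n) ⟨
    √ (fromℕ n) * √ (fromℕ n)  ∎)

  expectedRatio∈Θ√n : ∀ (v : (n : ℕ) → Vector Carrier n) →
    (∀ n → 16 ℕ.< n → IsUnitTopEigenvector (adjacency (G n)) (v n)) →
    (λ n → expectedRatio (adjacency (G n)) (v n)) ∈Θ (λ n → √ (fromℕ n))
  -- The threshold 100 makes √n ≥ 10, as `double≤` demands.
  expectedRatio∈Θ√n v top = half , fromℕ 1 , 0<half , fromℕ-pos 0 , 100 , bounds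
    where
    E : ℕ → Carrier
    E n = expectedRatio (adjacency (G n)) (v n)
    bounds : ∀ n → 100 ℕ.≤ n → 0# ≤ half * √ (fromℕ n) × half * √ (fromℕ n) ≤ E n × E n ≤ fromℕ 1 * √ (fromℕ n)
    bounds (suc m) 100≤n =
        *-nonneg (inj₁ 0<half) (√-nonneg (fromℕ (suc m)))
      , *-cancelˡ-≤ (fromℕ-pos 1) (≤-trans (inj₂ (2*[half*x]≈x _))
          (double≤ (√n≤expectedRatio+5 16<n (top (suc m) 16<n))
                   (≤-trans (inj₂ fromℕ10≈) (10≤√n 100≤n))))
      , ≤-trans (expectedRatio≤√n 16<n (top (suc m) 16<n)) (inj₂ (sym (1*x≈x _)))
      where
      16<n : 16 ℕ.< suc m
      16<n = ℕ.≤-trans (ℕ.m≤n+m 17 83) 100≤n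

  -- After multiplication by √n > 0 the three inequalities become 0 ≤ OPT, OPT ≤ n and n ≤ 2·OPT.
  -- All hold from n = 17, where the hypothesis on OPT sets in and n ≥ 10 is already satisfied.
  √n∈ΘOPT/√n : ∀ (OPT : ℕ → Carrier) → (∀ n → 16 ℕ.< n → IsOPT (adjacency (G n)) (OPT n)) →
    (λ n → √ (fromℕ n)) ∈Θ (λ n → OPT n / √ (fromℕ n))
  √n∈ΘOPT/√n OPT isOPT = fromℕ 1 , fromℕ 2 , fromℕ-pos 0 , fromℕ-pos 1 , 17 , bounds
    where
    OPT/√n : ℕ → Carrier
    OPT/√n n = OPT n / √ (fromℕ n)
    bounds : ∀ n → 17 ℕ.≤ n →
             0# ≤ fromℕ 1 * OPT/√n n × fromℕ 1 * OPT/√n n ≤ √ (fromℕ n) × √ (fromℕ n) ≤ fromℕ 2 * OPT/√n n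
    bounds (suc m) 16<n =
        ≤-trans (*-cancelˡ-≤ 0<s (begin
          s * 0#            ≈⟨ zeroʳ s ⟩
          0#                ≤⟨ 0≤OPT ⟩
          OPT n             ≈⟨ *-/-cancel (pos⇒≉0 0<s) ⟨
          s * OPT/√n n      ∎)) (inj₂ (sym (1*x≈x _)))
      , ≤-trans (inj₂ (1*x≈x _)) (*-cancelˡ-≤ 0<s (begin
          s * OPT/√n n      ≈⟨ *-/-cancel (pos⇒≉0 0<s) ⟩
          OPT n             ≤⟨ OPT≤n 16<n (isOPT n 16<n) ⟩
          fromℕ n           ≈⟨ √-square (fromℕ-nonneg n) ⟨
          s * s             ∎))
      , *-cancelˡ-≤ 0<s (begin
          s * s                     ≈⟨ √-square (fromℕ-nonneg n) ⟩
          fromℕ n                   ≤⟨ n≤2OPT ⟩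
          fromℕ 2 * OPT n           ≈⟨ *-congˡ (*-/-cancel (pos⇒≉0 0<s)) ⟨
          fromℕ 2 * (s * OPT/√n n)  ≈⟨ *-assoc _ _ _ ⟨
          fromℕ 2 * s * OPT/√n n    ≈⟨ *-congʳ (*-comm _ _) ⟩
          s * fromℕ 2 * OPT/√n n    ≈⟨ *-assoc _ _ _ ⟩
          s * (fromℕ 2 * OPT/√n n)  ∎)
      where
      n = suc m
      s = √ (fromℕ n)
      n≤2OPT : fromℕ n ≤ fromℕ 2 * OPT n
      n≤2OPT = double≤ (n≤OPT+5 16<n (isOPT n 16<n))
        (≤-trans (inj₂ fromℕ10≈) (fromℕ-mono-≤ (ℕ.≤-trans (ℕ.m≤n+m 10 7) 16<n)))
      0≤OPT : 0# ≤ OPT n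
      0≤OPT = *-cancelˡ-≤ (fromℕ-pos 1) (begin
        fromℕ 2 * 0#     ≈⟨ zeroʳ _ ⟩
        0#               ≤⟨ fromℕ-nonneg n ⟩
        fromℕ n          ≤⟨ n≤2OPT ⟩
        fromℕ 2 * OPT n  ∎)
      0<s : 0# < s
      0<s with √-nonneg (fromℕ n)
      ... | inj₁ 0<s = 0<s
      ... | inj₂ 0≈s = contradiction
        (trans (sym (√-square (fromℕ-nonneg n))) (trans (*-congʳ (sym 0≈s)) (zeroˡ _)))
        (pos⇒≉0 (fromℕ-pos m))

mainTheorem3 :
  (ℝ : RealNumbers) → let open Eigensign ℝ in
  (v : (n : ℕ) → Vector Carrier n) →
  ((n : ℕ) → 16 ℕ.< n → IsUnitTopEigenvector (adjacency (G n)) (v n)) →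
  (OPT : ℕ → Carrier) →
  ((n : ℕ) → 16 ℕ.< n → IsOPT (adjacency (G n)) (OPT n)) →
  let E = λ n → expectedRatio (adjacency (G n)) (v n)
      √n = λ n → √ (fromℕ n)
      OPT/√n = λ n → OPT n / √ (fromℕ n)
  in (E ∈Θ √n) × (√n ∈Θ OPT/√n) × (E ∈Θ OPT/√n)
mainTheorem3 ℝ v top OPT isOPT = E∈Θ√n , √n∈ΘOPT , ∈Θ-trans E∈Θ√n √n∈ΘOPT
  where
  open OrderedField ℝ using (∈Θ-trans)
  open Asymptotics ℝ
  E∈Θ√n = expectedRatio∈Θ√n v top
  √n∈ΘOPT = √n∈ΘOPT/√n OPT isOPT
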